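{- Let $n\ge 0$ and $\Phi\in\mathrm{End}(\mathcal{Q})$, and suppose that the numbers $c_{\alpha,(n)}$, $\alpha\in\operatorname{Comp}(n)$, are nonnegative and not all zero. Then $\lambda^n>0$, the matrix $\overline{K}=(\overline{K}(\alpha,\beta))_{\alpha,\beta\in\operatorname{Comp}(n)}$ is stochastic (nonnegative entries, every row summing to $1$), and $\overline{K}$ lumps $K$ by descent sets: for every $\beta\in\operatorname{Comp}(n)$ and all $\pi,\tau\in\mathfrak{S}_n$ with $D(\pi)=D(\tau)$, $$\sum_{\sigma\in\mathfrak{S}_n:\,D(\sigma)=\beta}K(\pi,\sigma)=\sum_{\sigma\in\mathfrak{S}_n:\,D(\sigma)=\beta}K(\tau,\sigma),$$ and this common value equals $\overline{K}(D(\pi),\beta)$.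
   Context: Work over $\mathbb{Q}$. A composition of $n\ge0$ is a sequence $\alpha=(a_1,\dots,a_k)$ of positive integers with sum $n$; $\operatorname{Comp}(n)$ is the set of them, $(n)$ is the one-part composition and $(1^n)$ the composition with $n$ parts equal to $1$. Put $S_\alpha=\{a_1,a_1+a_2,\dots,a_1+\dots+a_{k-1}\}\subseteq[n-1]$; $\alpha\mapsto S_\alpha$ is a bijection onto subsets of $[n-1]$ with inverse $S\mapsto \operatorname{co}(S)$. Order $\operatorname{Comp}(n)$ by $\alpha\le\beta$ iff $S_\alpha\subseteq S_\beta$. The monomial quasisymmetric function is $M_\alpha=\sum_{i_1<\dots<i_k}x_{i_1}^{a_1}\cdots x_{i_k}^{a_k}$; $\mathcal{Q}_n$ is the span of $\{M_\alpha\}_{\alpha\in\operatorname{Comp}(n)}$ and $\mathcal{Q}=\bigoplus_n\mathcal{Q}_n$ is a graded Hopf algebra with the usual product of power series and coproduct $\Delta(M_\alpha)=\sum_{\alpha=\beta\cdot\gamma}M_\beta\otimes M_\gamma$ (sum over ways of writing $\alpha$ as a concatenation of two possibly empty compositions). The fundamental quasisymmetric functions are $F_\alpha=\sum_{\beta\ge\alpha}M_\beta$. $\mathrm{End}(\mathcal{Q})$ denotes the set of (graded) Hopf algebra endomorphisms of $\mathcal{Q}$. For $\sigma\in\mathfrak{S}_n$ (written $(\sigma_1,\dots,\sigma_n)$, $\sigma_i=\sigma(i)$, product = composition of maps), $\operatorname{Des}(\sigma)=\{i\in[n-1]:\sigma_i>\sigma_{i+1}\}$ and $D(\sigma)=\operatorname{co}(\operatorname{Des}(\sigma))$.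 For $\Phi\in\mathrm{End}(\mathcal{Q})$ define $c_{\alpha,\beta}$ ($\alpha,\beta\in\operatorname{Comp}(n)$) by $\Phi(F_\alpha)=\sum_\beta c_{\alpha,\beta}F_\beta$, and $\lambda$ by $\Phi(M_{(1)})=\lambda M_{(1)}$. When the $c_{\alpha,(n)}$ are nonnegative and not all zero, define the probability distribution $\mathrm{Prob}_\Phi(\pi)=c_{D(\pi),(n)}/\sum_{\sigma\in\mathfrak{S}_n}c_{D(\sigma),(n)}$ on $\mathfrak{S}_n$, and the $\mathfrak{S}_n\times\mathfrak{S}_n$ matrix $K$ by $K(\pi,\sigma\pi)=\mathrm{Prob}_\Phi(\sigma^{ -1})$. When $\lambda\neq0$, define $\overline{K}(\alpha,\beta)=c_{\alpha,\beta}/\lambda^n$. -}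

module Defs where

open import Data.Bool using (Bool; true; false; if_then_else_; _∧_)
open import Data.Nat as ℕ using (ℕ; zero; suc; _∸_; _<ᵇ_; _≡ᵇ_)
open import Data.List using (List; []; _∷_; _++_; map; concat; concatMap; foldr; length; take; drop; filter)
open import Data.Bool.ListAction using (all; any)
open import Data.List.Properties using (≡-dec)
open import Data.Product using (_×_; _,_; proj₁; proj₂)
open import Data.Rational using (ℚ; 0ℚ; 1ℚ; _+_; _*_; _-_; _÷_; ≢-nonZero)
open import Data.Rational.Properties using (_≟_)
open import Relation.Nullary using (yes; no; Dec)
open import Relation.Nullary.Decidable using (⌊_⌋)

-- Compositions are lists of positive naturals.

Comp : Set
Comp = List ℕ

size : Comp → ℕ
size = foldr ℕ._+_ 0

private
  incHead : Comp → Comp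
  incHead []       = []
  incHead (x ∷ xs) = suc x ∷ xs

  compsSuc : ℕ → List Comp
  compsSuc zero    = (1 ∷ []) ∷ []
  compsSuc (suc m) = map (1 ∷_) (compsSuc m) ++ map incHead (compsSuc m)

-- Comp(n), enumerated (each composition exactly once)
comps : ℕ → List Comp
comps zero    = [] ∷ []
comps (suc m) = compsSuc m

-- The one-part composition (n); for n = 0 this is the empty composition,
-- the unique element of Comp(0).
top : ℕ → Comp
top zero    = []
top (suc m) = suc m ∷ []

_==_ : Comp → Comp → Bool
α == β = ⌊ ≡-dec ℕ._≟_ α β ⌋

private
  partial : ℕ → Comp → List ℕ
  partial s []           = []
  partial s (a ∷ [])     = []
  partial s (a ∷ b ∷ as) = (s ℕ.+ a) ∷ partial (s ℕ.+ a) (b ∷ as)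

S : Comp → List ℕ
S = partial 0

_≤C_ : Comp → Comp → Bool
α ≤C β = all (λ s → any (λ t → s ≡ᵇ t) (S β)) (S α)

-- co(S) for S ⊆ [n-1] given as an increasing list
private
  diffs : List ℕ → List ℕ
  diffs []           = []
  diffs (a ∷ [])     = []
  diffs (a ∷ b ∷ bs) = (b ∸ a) ∷ diffs (b ∷ bs)

co : ℕ → List ℕ → Comp
co zero    _  = []
co (suc m) xs = diffs (0 ∷ xs ++ (suc m ∷ []))

sumℚ : List ℚ → ℚ
sumℚ = foldr _+_ 0ℚ

powℚ : ℚ → ℕ → ℚ
powℚ q zero    = 1ℚ
powℚ q (suc n) = q * powℚ q n

-- total division (p / 0 := 0); only used with nonzero denominators
-- under the hypotheses of the theorem
_/′_ : ℚ → ℚ → ℚ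
p /′ q with q ≟ 0ℚ
... | yes _ = 0ℚ
... | no q≢0 = _÷_ p q {{≢-nonZero q≢0}}

-- Elements of 𝒬 written in the M-basis: formal finite sums Σ c·M_γ,
-- and elements of 𝒬 ⊗ 𝒬 in the basis M_β ⊗ M_γ.

LC : Set
LC = List (ℚ × Comp)

LC₂ : Set
LC₂ = List (ℚ × Comp × Comp)

coef : LC → Comp → ℚ
coef v γ = sumℚ (map (λ p → if proj₂ p == γ then proj₁ p else 0ℚ) v)

coef₂ : LC₂ → Comp → Comp → ℚ
coef₂ v β γ = sumℚ (map (λ p → if (proj₁ (proj₂ p) == β) ∧ (proj₂ (proj₂ p) == γ)
                               then proj₁ p else 0ℚ) v)

scale : ℚ → LC → LC
scale c = map (λ p → (c * proj₁ p , proj₂ p))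

-- quasi-shuffle: M_α M_β = Σ_{γ ∈ qsh α β} M_γ  (with multiplicity)
qsh : Comp → Comp → List Comp
qsh []       ys       = ys ∷ []
qsh (x ∷ xs) []       = (x ∷ xs) ∷ []
qsh (x ∷ xs) (y ∷ ys) =
  map (x ∷_) (qsh xs (y ∷ ys)) ++ map (y ∷_) (qsh (x ∷ xs) ys)
  ++ map ((x ℕ.+ y) ∷_) (qsh xs ys)

mulLC : LC → LC → LC
mulLC u v = concatMap (λ p → concatMap (λ q →
              map (λ γ → (proj₁ p * proj₁ q , γ)) (qsh (proj₂ p) (proj₂ q))) v) u

private
  upto : ℕ → List ℕ
  upto zero    = 0 ∷ []
  upto (suc n) = upto n ++ (suc n ∷ [])

ΔM : Comp → LC₂
ΔM α = map (λ i → (1ℚ , take i α , drop i α)) (upto (length α))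

ΔLC : LC → LC₂
ΔLC v = concatMap (λ p → map (λ t → (proj₁ p * proj₁ t , proj₂ t)) (ΔM (proj₂ p))) v

-- Graded linear endomorphisms of 𝒬, given by their matrix in the
-- M-basis:  Φ(M_α) = Σ_{β ∈ Comp(|α|)} Φ α β · M_β.

Endo : Set
Endo = Comp → Comp → ℚ

applyM : Endo → Comp → LC
applyM Φ α = map (λ β → (Φ α β , β)) (comps (size α))

apply : Endo → LC → LC
apply Φ v = concatMap (λ p → scale (proj₁ p) (applyM Φ (proj₂ p))) v

apply⊗ : Endo → LC₂ → LC₂
apply⊗ Φ v = concatMap (λ p →
  concatMap (λ b → map (λ g → (proj₁ p * proj₁ b * proj₁ g , proj₂ b , proj₂ g))
                       (applyM Φ (proj₂ (proj₂ p))))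
            (applyM Φ (proj₁ (proj₂ p)))) v

M : Comp → LC
M α = (1ℚ , α) ∷ []

open import Data.List.Membership.Propositional using (_∈_)
open import Relation.Binary.PropositionalEquality using (_≡_)

εM : Comp → ℚ
εM []      = 1ℚ
εM (_ ∷ _) = 0ℚ

-- Φ is a (graded) Hopf algebra endomorphism of 𝒬
-- (a bialgebra endomorphism of a Hopf algebra automatically commutes
-- with the antipode).
record IsHopfEndo (Φ : Endo) : Set where
  field
    unit   : Φ [] [] ≡ 1ℚ
    mult   : ∀ {m k α β} → α ∈ comps m → β ∈ comps k → ∀ γ →
             coef (apply Φ (mulLC (M α) (M β))) γ ≡ coef (mulLC (applyM Φ α) (applyM Φ β)) γ
    counit : ∀ {m α} → α ∈ comps m → coef (applyM Φ α) [] ≡ εM α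
    comult : ∀ {m α} → α ∈ comps m → ∀ β γ →
             coef₂ (apply⊗ Φ (ΔM α)) β γ ≡ coef₂ (ΔLC (applyM Φ α)) β γ

F : Comp → LC
F α = map (λ β → (1ℚ , β)) (filter (λ β → Data.Bool._≟_ (α ≤C β) true) (comps (size α)))
  where import Data.Bool

-- λ : Φ(M_(1)) = λ M_(1)
lam : Endo → ℚ
lam Φ = Φ (1 ∷ []) (1 ∷ [])

-- Permutations of [n] in one-line notation (σ₁, …, σₙ).

private
  insertAll : ℕ → List ℕ → List (List ℕ)
  insertAll x []       = (x ∷ []) ∷ []
  insertAll x (y ∷ ys) = (x ∷ y ∷ ys) ∷ map (y ∷_) (insertAll x ys)

-- 𝔖ₙ, enumerated (each permutation exactly once)
perms : ℕ → List (List ℕ)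
perms zero    = [] ∷ []
perms (suc n) = concatMap (insertAll (suc n)) (perms n)

-- σ(i), 1-based
at : List ℕ → ℕ → ℕ
at []       _             = 0
at (x ∷ xs) (suc zero)    = x
at (x ∷ xs) (suc (suc i)) = at xs (suc i)
at (x ∷ xs) zero          = 0

oneTo : ℕ → List ℕ
oneTo zero    = []
oneTo (suc n) = oneTo n ++ (suc n ∷ [])

_∘ₚ_ : List ℕ → List ℕ → List ℕ
σ ∘ₚ π = map (at σ) π

private
  indexOf : ℕ → List ℕ → ℕ
  indexOf j []       = 0
  indexOf j (x ∷ xs) = if j ≡ᵇ x then 1 else suc (indexOf j xs)

inv : List ℕ → List ℕ
inv σ = map (λ j → indexOf j σ) (oneTo (length σ))

Des : List ℕ → List ℕ
Des σ = filter (λ i → Data.Bool._≟_ (at σ (suc i) <ᵇ at σ i) true) (oneTo (length σ ∸ 1))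
  where import Data.Bool

D : List ℕ → Comp
D σ = co (length σ) (Des σ)

-- The quantities of the theorem, for Φ with F-expansion coefficients c
-- in degree n.

Prob : ℕ → (Comp → Comp → ℚ) → List ℕ → ℚ
Prob n c π = c (D π) (top n) /′ sumℚ (map (λ σ → c (D σ) (top n)) (perms n))

-- K(π, ρ) = Prob(σ⁻¹) where σ is the (unique) permutation with σπ = ρ
K : ℕ → (Comp → Comp → ℚ) → List ℕ → List ℕ → ℚ
K n c π ρ = sumℚ (map (λ σ → if (σ ∘ₚ π) == ρ then Prob n c (inv σ) else 0ℚ) (perms n))

Kbar : ℕ → Endo → (Comp → Comp → ℚ) → Comp → Comp → ℚ
Kbar n Φ c α β = c α β /′ powℚ (lam Φ) n

lumpSum : ℕ → (Comp → Comp → ℚ) → List ℕ → Comp → ℚ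
lumpSum n c π β = sumℚ (map (λ σ → if D σ == β then K n c π σ else 0ℚ) (perms n))

{-# OPTIONS --safe #-}
module Submission where

-- Let χ(f) be the coefficient of M_(n) in Φ(f); this is a character of 𝒬, and χ(F_α) = c_{α,(n)}.
-- Since Φ respects the coproduct, the coefficient of M_γ in Φ(F_{D(π)}) is the product of the
-- χ(F_{D(w)}) over the consecutive blocks w of π of lengths γ. By the shuffle formula for the product
-- of fundamental functions it is the sum of χ(F_{D(u)}) over the shuffles u of these blocks. Such a u
-- is σ⁻¹ for a σ such that σπ increases along the blocks, i.e. D(σπ) ≤ γ. Hence
--   Σ_{β ≤ γ} c_{D(π),β} = Σ_{σ : D(σπ) ≤ γ} c_{D(σ⁻¹),(n)},
-- and, as this holds for all γ, the terms with D(σπ) = β sum up to c_{D(π),β}. The normalising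
-- constant is χ(F_(1)ⁿ) = λⁿ, since F_(1)ⁿ is the sum of the F_{D(σ)} over all σ.

open import Defs
open import Data.Nat using (ℕ)
open import Data.List using (List; map; concatMap)
open import Data.Product using (_×_; Σ; _,_)
open import Data.Rational using (ℚ; 0ℚ; 1ℚ; _≤_; _<_)
open import Data.List.Membership.Propositional using (_∈_)
open import Relation.Binary.PropositionalEquality using (_≡_; _≢_)

open import Algebra.Bundles using (module CommutativeMonoid)
open import Data.Bool as Bool using (Bool; true; false; if_then_else_; T; _∧_; _∨_)
open import Data.Bool.ListAction using (all; any)
open import Data.Bool.Properties using (T-≡; ¬-not)
open import Data.List using ([]; _∷_; _++_; concat; filter; length; replicate; take; drop)
open import Data.List.Membership.DecPropositional Data.Nat._≟_ using (_∈?_)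
open import Data.List.Membership.Propositional using (_∉_; find; lose)
open import Data.List.Membership.Propositional.Properties
  using (∈-++⁺ˡ; ∈-++⁺ʳ; ∈-++⁻; ∈-map⁺; ∈-map⁻; ∈-filter⁺; ∈-filter⁻; ∈-concatMap⁺; ∈-concatMap⁻; ∈-∃++)
open import Data.List.Membership.Propositional.Properties.WithK using (unique∧set⇒bag)
open import Data.List.Properties
  using (≡-dec; map-++; map-∘; map-cong; map-cong-local; map-id-local; length-map; length-++; length-drop;
         ∷-injectiveˡ; ∷-injectiveʳ; ++-identityʳ; take-map; drop-map; take++drop≡id; filter-++; filter-all; filter-none)
open import Data.List.Relation.Binary.BagAndSetEquality using (∼bag⇒↭)
open import Data.List.Relation.Binary.Permutation.Propositional
  as Perm using (_↭_; ↭-refl; ↭-sym; ↭-trans; ↭-prep; ↭-reflexive; ↭⇒↭ₛ)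
import Data.List.Relation.Binary.Permutation.Propositional.Properties as PermP
import Data.List.Relation.Binary.Permutation.Setoid.Properties as PermS
open import Data.List.Relation.Ternary.Interleaving.Propositional
  using (Interleaving; []; consˡ; consʳ; toPermutation)
open import Data.List.Relation.Unary.All as All using (All; []; _∷_)
import Data.List.Relation.Unary.All.Properties as AllP
open import Data.List.Relation.Unary.AllPairs as AllPairs using (AllPairs; []; _∷_)
import Data.List.Relation.Unary.AllPairs.Properties as AllPairsP
open import Data.List.Relation.Unary.Any using (here; there)
open import Data.List.Relation.Unary.Unique.Propositional using (Unique)
import Data.List.Relation.Unary.Unique.Propositional.Properties as Uniq
open import Data.Nat as ℕ using (zero; suc; _∸_; _<ᵇ_; _≡ᵇ_; z<s; s≤s; s<s; z≤n)
import Data.Nat.Properties as ℕP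
open import Data.Product using (proj₁; proj₂; ∃)
open import Data.Rational using (_+_; _*_; 1/_; ≢-nonZero; nonNegative; positive)
import Data.Rational.Properties as ℚP
open import Data.Sum using (_⊎_; inj₁; inj₂)
open import Data.Unit using (⊤; tt)
open import Function using (_∘_; id; _on_)
open import Function.Bundles using (mk⇔; module Equivalence)
open import Level using (0ℓ)
open import Relation.Binary using (Rel; tri<; tri≈; tri>)
open import Relation.Binary.PropositionalEquality
  using (refl; sym; trans; cong; cong₂; subst; subst₂; ≢-sym; setoid; module ≡-Reasoning)
open import Relation.Nullary using (yes; no; contradiction; ¬_; ¬?)
open import Relation.Unary using (Pred)
import Relation.Unary as Unary
open import Algebra.Properties.CommutativeSemigroup
  (CommutativeMonoid.commutativeSemigroup ℚP.+-0-commutativeMonoid)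
  using () renaming (interchange to +-interchange; x∙yz≈y∙xz to +-leftComm)
open import Algebra.Properties.CommutativeSemigroup ℕP.+-commutativeSemigroup
  using (interchange; x∙yz≈y∙xz)
open import Algebra.Properties.Group ℚP.+-0-group using (∙-cancelʳ)

-- Compositions are replaced as indices by words with distinct letters. The fundamental function of
-- D(w) is handled through `E w`, which is defined by recursion on w, so that the coproduct becomes
-- cutting a word and the product becomes shuffling, with no choice of representatives. The main
-- obstacle is the shuffle rule. A shuffle adds one letter at a time, whereas the quasi-shuffle of
-- compositions adds a whole part. The two become comparable when the shuffles are sorted by an
-- initial increasing run, which is where the first part of a composition comes from. The last step
-- of the overview, from all sums over β ≤ γ to single β, is the unitriangularity of the F in terms
-- of the M. It is proved by induction, without Möbius inversion. The hypotheses give signs only in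
-- the column (n). Nonnegativity of the other entries is read off the lumped sums of K, at a
-- permutation with the given descent composition. The number λⁿ enters twice: through the product,
-- as the normalising constant, and through the coproduct, as the coefficient of M at (1ⁿ), which is
-- the row sum.

private
  variable
    A B : Set

-- Indicators and finite sums

[_]·_ : Bool → ℚ → ℚ
[ b ]· q = if b then q else 0ℚ

infixr 6.5 [_]·_

[]·-* : ∀ b q r → ([ b ]· q) * r ≡ [ b ]· q * r
[]·-* true  q r = refl
[]·-* false q r = ℚP.*-zeroˡ r

*-[]· : ∀ b q r → q * ([ b ]· r) ≡ [ b ]· q * r
*-[]· true  q r = refl
*-[]· false q r = ℚP.*-zeroʳ q

[]·-0 : ∀ b → [ b ]· 0ℚ ≡ 0ℚ
[]·-0 true  = refl
[]·-0 false = refl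

[]·-∧ : ∀ b c q → [ b ∧ c ]· q ≡ [ b ]· [ c ]· q
[]·-∧ true  c q = refl
[]·-∧ false c q = refl

==-≡ : ∀ {α β} → α ≡ β → (α == β) ≡ true
==-≡ {α} refl with ≡-dec ℕ._≟_ α α
... | yes _  = refl
... | no α≢α = contradiction refl α≢α

==-≢ : ∀ {α β} → α ≢ β → (α == β) ≡ false
==-≢ {α} {β} α≢β with ≡-dec ℕ._≟_ α β
... | yes α≡β = contradiction α≡β α≢β
... | no _    = refl

∑ : List A → (A → ℚ) → ℚ
∑ xs f = sumℚ (map f xs)

∑-cong∈ : ∀ (xs : List A) {f g : A → ℚ} → (∀ {x} → x ∈ xs → f x ≡ g x) → ∑ xs f ≡ ∑ xs g
∑-cong∈ []       e = refl
∑-cong∈ (x ∷ xs) e = cong₂ _+_ (e (here refl)) (∑-cong∈ xs (e ∘ there))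

∑-cong : ∀ (xs : List A) {f g : A → ℚ} → (∀ x → f x ≡ g x) → ∑ xs f ≡ ∑ xs g
∑-cong xs e = ∑-cong∈ xs (λ {x} _ → e x)

∑-++ : ∀ (xs ys : List A) (f : A → ℚ) → ∑ (xs ++ ys) f ≡ ∑ xs f + ∑ ys f
∑-++ []       ys f = sym (ℚP.+-identityˡ _)
∑-++ (x ∷ xs) ys f = trans (cong (f x +_) (∑-++ xs ys f)) (sym (ℚP.+-assoc (f x) (∑ xs f) (∑ ys f)))

∑-map : ∀ (g : A → B) (xs : List A) (f : B → ℚ) → ∑ (map g xs) f ≡ ∑ xs (λ x → f (g x))
∑-map g xs f = cong sumℚ (sym (map-∘ xs))

∑-concatMap : ∀ (g : A → List B) (xs : List A) (f : B → ℚ) →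
              ∑ (concatMap g xs) f ≡ ∑ xs (λ x → ∑ (g x) f)
∑-concatMap g []       f = refl
∑-concatMap g (x ∷ xs) f =
  trans (∑-++ (g x) (concatMap g xs) f) (cong (∑ (g x) f +_) (∑-concatMap g xs f))

∑-zero : ∀ (xs : List A) {f : A → ℚ} → (∀ {x} → x ∈ xs → f x ≡ 0ℚ) → ∑ xs f ≡ 0ℚ
∑-zero []       e = refl
∑-zero (x ∷ xs) e = trans (cong₂ _+_ (e (here refl)) (∑-zero xs (e ∘ there))) (ℚP.+-identityˡ 0ℚ)

∑-+ : ∀ (xs : List A) (f g : A → ℚ) → ∑ xs (λ x → f x + g x) ≡ ∑ xs f + ∑ xs g
∑-+ []       f g = sym (ℚP.+-identityˡ 0ℚ)
∑-+ (x ∷ xs) f g =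
  trans (cong (f x + g x +_) (∑-+ xs f g)) (+-interchange (f x) (g x) (∑ xs f) (∑ xs g))

*-∑ : ∀ q (xs : List A) (f : A → ℚ) → q * ∑ xs f ≡ ∑ xs (λ x → q * f x)
*-∑ q []       f = ℚP.*-zeroʳ q
*-∑ q (x ∷ xs) f = trans (ℚP.*-distribˡ-+ q (f x) (∑ xs f)) (cong (q * f x +_) (*-∑ q xs f))

∑-* : ∀ (xs : List A) (f : A → ℚ) q → ∑ xs f * q ≡ ∑ xs (λ x → f x * q)
∑-* []       f q = ℚP.*-zeroˡ q
∑-* (x ∷ xs) f q = trans (ℚP.*-distribʳ-+ q (f x) (∑ xs f)) (cong (f x * q +_) (∑-* xs f q))

∑-*-∑ : ∀ (xs : List A) (ys : List B) f g →
        ∑ xs f * ∑ ys g ≡ ∑ xs (λ x → ∑ ys (λ y → f x * g y))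
∑-*-∑ xs ys f g = trans (∑-* xs f (∑ ys g)) (∑-cong xs (λ x → *-∑ (f x) ys g))

∑-swap : ∀ (xs : List A) (ys : List B) (f : A → B → ℚ) →
         ∑ xs (λ x → ∑ ys (f x)) ≡ ∑ ys (λ y → ∑ xs (λ x → f x y))
∑-swap []       ys f = sym (∑-zero ys (λ _ → refl))
∑-swap (x ∷ xs) ys f =
  trans (cong (∑ ys (f x) +_) (∑-swap xs ys f)) (sym (∑-+ ys (f x) (λ y → ∑ xs (λ z → f z y))))

∑-[]· : ∀ b (xs : List A) (f : A → ℚ) → ∑ xs (λ x → [ b ]· f x) ≡ [ b ]· ∑ xs f
∑-[]· true  xs f = refl
∑-[]· false xs f = ∑-zero xs (λ _ → refl)

∑-filter : ∀ (b : A → Bool) (xs : List A) (f : A → ℚ) →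
           ∑ (filter (λ x → b x Bool.≟ true) xs) f ≡ ∑ xs (λ x → [ b x ]· f x)
∑-filter b []       f = refl
∑-filter b (x ∷ xs) f with b x
... | true  = cong (f x +_) (∑-filter b xs f)
... | false = trans (∑-filter b xs f) (sym (ℚP.+-identityˡ _))

∑-↭ : ∀ {xs ys : List A} (f : A → ℚ) → xs ↭ ys → ∑ xs f ≡ ∑ ys f
∑-↭ f Perm.refl          = refl
∑-↭ f (Perm.prep x p)    = cong (f x +_) (∑-↭ f p)
∑-↭ f (Perm.swap {xs = xs} {ys} x y p) = begin
  f x + (f y + ∑ xs f) ≡⟨ ℚP.+-assoc (f x) (f y) (∑ xs f) ⟨
  (f x + f y) + ∑ xs f ≡⟨ cong₂ _+_ (ℚP.+-comm (f x) (f y)) (∑-↭ f p) ⟩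
  (f y + f x) + ∑ ys f ≡⟨ ℚP.+-assoc (f y) (f x) (∑ ys f) ⟩
  f y + (f x + ∑ ys f) ∎
  where open ≡-Reasoning
∑-↭ f (Perm.trans p q)   = trans (∑-↭ f p) (∑-↭ f q)

∑-δ : ∀ {xs : List Comp} {γ} (f : Comp → ℚ) → Unique xs → γ ∈ xs →
      ∑ xs (λ β → [ β == γ ]· f β) ≡ f γ
∑-δ {x ∷ xs} {.x} f (x∉ ∷ _) (here refl) =
  trans (cong₂ _+_ (cong (λ b → [ b ]· f x) (==-≡ {x} refl))
                   (∑-zero xs (λ {y} y∈ → cong (λ b → [ b ]· f y) (==-≢ (λ y≡x → All.lookup x∉ y∈ (sym y≡x))))))
        (ℚP.+-identityʳ (f x))
∑-δ {x ∷ xs} {γ} f (x∉ ∷ u) (there γ∈) =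
  trans (cong₂ _+_ (cong (λ b → [ b ]· f x) (==-≢ (All.lookup x∉ γ∈))) (∑-δ f u γ∈))
        (ℚP.+-identityˡ (f γ))

∑-≥0 : ∀ (xs : List A) {f : A → ℚ} → (∀ {x} → x ∈ xs → 0ℚ ≤ f x) → 0ℚ ≤ ∑ xs f
∑-≥0 []       f≥0 = ℚP.≤-refl
∑-≥0 (x ∷ xs) f≥0 = ℚP.+-mono-≤ (f≥0 (here refl)) (∑-≥0 xs (f≥0 ∘ there))

∑->0 : ∀ {xs : List A} {f : A → ℚ} {y} → (∀ {x} → x ∈ xs → 0ℚ ≤ f x) → y ∈ xs → 0ℚ < f y → 0ℚ < ∑ xs f
∑->0 {xs = x ∷ xs} f≥0 (here refl) fy>0 = ℚP.+-mono-<-≤ fy>0 (∑-≥0 xs (f≥0 ∘ there))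
∑->0 {xs = x ∷ xs} f≥0 (there y∈)  fy>0 = ℚP.+-mono-≤-< (f≥0 (here refl)) (∑->0 (f≥0 ∘ there) y∈ fy>0)

-- Compositions, built by deciding whether 1 is a cut

inc : Comp → Comp
inc []       = []
inc (x ∷ xs) = suc x ∷ xs

-- A composition of n + 2 arises from one of n + 1 by shifting its cut set by one and then deciding
-- about the new place 1: `cut` puts 1 into the set, `ext` leaves it out. Refinement, descent
-- compositions and `E` all follow this recursion.
data IsComp : ℕ → Comp → Set where
  nil : IsComp 0 []
  one : IsComp 1 (1 ∷ [])
  cut : ∀ {m x α} → IsComp (suc m) (x ∷ α) → IsComp (suc (suc m)) (1 ∷ x ∷ α)
  ext : ∀ {m x α} → IsComp (suc m) (x ∷ α) → IsComp (suc (suc m)) (suc x ∷ α)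

comps-suc : ∀ m → comps (suc (suc m)) ≡ map (1 ∷_) (comps (suc m)) ++ map inc (comps (suc m))
comps-suc m = cong (map (1 ∷_) (comps (suc m)) ++_)
                   (map-cong (λ { [] → refl ; (x ∷ xs) → refl }) (comps (suc m)))

∈comps⇒IsComp : ∀ n {α} → α ∈ comps n → IsComp n α
∈comps⇒IsComp zero          (here refl) = nil
∈comps⇒IsComp (suc zero)    (here refl) = one
∈comps⇒IsComp (suc (suc m)) α∈ = extend (∈comps⇒IsComp (suc m)) (subst (_ ∈_) (comps-suc m) α∈)
  where
  extend : (∀ {β} → β ∈ comps (suc m) → IsComp (suc m) β) →
           ∀ {α} → α ∈ map (1 ∷_) (comps (suc m)) ++ map inc (comps (suc m)) → IsComp (suc (suc m)) α
  extend ih α∈ with ∈-++⁻ (map (1 ∷_) (comps (suc m))) α∈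
  extend ih α∈ | inj₁ p with ∈-map⁻ (1 ∷_) p
  ... | [] , β∈ , refl with () ← ih β∈
  ... | _ ∷ _ , β∈ , refl = cut (ih β∈)
  extend ih α∈ | inj₂ p with ∈-map⁻ inc p
  ... | [] , β∈ , refl with () ← ih β∈
  ... | _ ∷ _ , β∈ , refl = ext (ih β∈)

IsComp⇒∈comps : ∀ {n α} → IsComp n α → α ∈ comps n
IsComp⇒∈comps nil = here refl
IsComp⇒∈comps one = here refl
IsComp⇒∈comps (cut {m} i) =
  subst (_ ∈_) (sym (comps-suc m)) (∈-++⁺ˡ (∈-map⁺ (1 ∷_) (IsComp⇒∈comps i)))
IsComp⇒∈comps (ext {m} i) =
  subst (_ ∈_) (sym (comps-suc m)) (∈-++⁺ʳ (map (1 ∷_) (comps (suc m))) (∈-map⁺ inc (IsComp⇒∈comps i)))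

IsComp-size : ∀ {n α} → IsComp n α → size α ≡ n
IsComp-size nil     = refl
IsComp-size one     = refl
IsComp-size (cut i) = cong suc (IsComp-size i)
IsComp-size (ext i) = cong suc (IsComp-size i)

Positive : List ℕ → Set
Positive = All (0 ℕ.<_)

IsComp-positive : ∀ {n α} → IsComp n α → Positive α
IsComp-positive nil     = []
IsComp-positive one     = z<s ∷ []
IsComp-positive (cut i) = z<s ∷ IsComp-positive i
IsComp-positive (ext i) with _ ∷ ps ← IsComp-positive i = z<s ∷ ps

positive⇒IsComp : ∀ {α} → Positive α → IsComp (size α) α
positive⇒IsComp []       = nil
positive⇒IsComp {suc x ∷ α} (_ ∷ ps) = go x
  where
  last : ∀ {α} → IsComp (size α) α → IsComp (suc (size α)) (1 ∷ α)
  last {[]}        i = one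
  last {zero ∷ α}  i with () ∷ _ ← IsComp-positive i
  last {suc x ∷ α} i = cut i
  go : ∀ x → IsComp (suc x ℕ.+ size α) (suc x ∷ α)
  go zero    = last (positive⇒IsComp ps)
  go (suc x) = ext (go x)

∈comps-size : ∀ {n α} → α ∈ comps n → size α ≡ n
∈comps-size {n} α∈ = IsComp-size (∈comps⇒IsComp n α∈)

top-IsComp : ∀ n → IsComp n (top n)
top-IsComp zero          = nil
top-IsComp (suc zero)    = one
top-IsComp (suc (suc n)) = ext (top-IsComp (suc n))

ones-IsComp : ∀ n → IsComp n (replicate n 1)
ones-IsComp zero          = nil
ones-IsComp (suc zero)    = one
ones-IsComp (suc (suc n)) = cut (ones-IsComp (suc n))

comps-unique : ∀ n → Unique (comps n)
comps-unique zero          = [] ∷ []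
comps-unique (suc zero)    = [] ∷ []
comps-unique (suc (suc m)) = subst Unique (sym (comps-suc m))
  (Uniq.++⁺ (Uniq.map⁺ ∷-injectiveʳ (comps-unique (suc m)))
            (Uniq.map⁺ inc-injective (comps-unique (suc m))) disjoint)
  where
  inc-injective : ∀ {α β} → inc α ≡ inc β → α ≡ β
  inc-injective {[]}    {[]}     _    = refl
  inc-injective {_ ∷ _} {_ ∷ _}  refl = refl
  disjoint : ∀ {α} → α ∈ map (1 ∷_) (comps (suc m)) × α ∈ map inc (comps (suc m)) → _
  disjoint (p , q) with ∈-map⁻ (1 ∷_) p | ∈-map⁻ inc q
  -- A composition beginning with 1 could only be an extension of one beginning with 0.
  ... | _ , _ , refl | zero ∷ _ , r , _ with () ∷ _ ← IsComp-positive (∈comps⇒IsComp (suc m) r)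

∑-comps : ∀ m f → ∑ (comps (suc (suc m))) f ≡
          ∑ (comps (suc m)) (λ α → f (1 ∷ α)) + ∑ (comps (suc m)) (λ α → f (inc α))
∑-comps m f = begin
  ∑ (comps (suc (suc m))) f
    ≡⟨ cong (λ xs → ∑ xs f) (comps-suc m) ⟩
  ∑ (map (1 ∷_) (comps (suc m)) ++ map inc (comps (suc m))) f
    ≡⟨ ∑-++ (map (1 ∷_) (comps (suc m))) _ f ⟩
  ∑ (map (1 ∷_) (comps (suc m))) f + ∑ (map inc (comps (suc m))) f
    ≡⟨ cong₂ _+_ (∑-map (1 ∷_) (comps (suc m)) f) (∑-map inc (comps (suc m)) f) ⟩
  _ ∎
  where open ≡-Reasoning

-- The refinement order

S-inc : ∀ x α → S (suc x ∷ α) ≡ map suc (S (x ∷ α))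
S-inc x []          = refl
S-inc x (y ∷ [])    = refl
S-inc x (y ∷ z ∷ α) = cong (suc x ∷_) (S-inc (x ℕ.+ y) (z ∷ α))

S-cut : ∀ x α → S (1 ∷ x ∷ α) ≡ 1 ∷ map suc (S (x ∷ α))
S-cut x []      = refl
S-cut x (y ∷ α) = cong (1 ∷_) (S-inc x (y ∷ α))

S-positive : ∀ {n α} → IsComp n α → Positive (S α)
S-positive nil = []
S-positive one = []
S-positive (cut {x = x} {α} i) = subst Positive (sym (S-cut x α)) (z<s ∷ AllP.map⁺ (All.universal (λ _ → z<s) _))
S-positive (ext {x = x} {α} i) = subst Positive (sym (S-inc x α)) (AllP.map⁺ (All.universal (λ _ → z<s) _))

mem : ℕ → List ℕ → Bool
mem s = any (s ≡ᵇ_)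

-- `α ≤C β` unfolds to `S α ⊑ S β`. On arbitrary lists the relation can be shifted by `suc`.
_⊑_ : List ℕ → List ℕ → Bool
xs ⊑ ys = all (λ s → mem s ys) xs

mem-suc : ∀ s ys → mem (suc s) (map suc ys) ≡ mem s ys
mem-suc s []       = refl
mem-suc s (y ∷ ys) = cong ((s ≡ᵇ y) ∨_) (mem-suc s ys)

mem-1 : ∀ {ys} → Positive ys → mem 1 (map suc ys) ≡ false
mem-1 []                 = refl
mem-1 {suc y ∷ ys} (_ ∷ ps) = mem-1 ps

⊑-suc : ∀ xs ys → map suc xs ⊑ map suc ys ≡ xs ⊑ ys
⊑-suc []       ys = refl
⊑-suc (x ∷ xs) ys = cong₂ _∧_ (mem-suc x ys) (⊑-suc xs ys)

⊑-suc-1 : ∀ {xs} ys → Positive xs → map suc xs ⊑ (1 ∷ map suc ys) ≡ xs ⊑ ys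
⊑-suc-1 ys []                    = refl
⊑-suc-1 {suc x ∷ xs} ys (_ ∷ ps) = cong₂ _∧_ (mem-suc (suc x) ys) (⊑-suc-1 ys ps)

module _ {m α β} (i : IsComp (suc m) α) (j : IsComp (suc m) β) where

  private
    head-view : ∀ {m α} → IsComp (suc m) α →
                (S (1 ∷ α) ≡ 1 ∷ map suc (S α)) × (S (inc α) ≡ map suc (S α))
    head-view {α = x ∷ α} i = S-cut x α , S-inc x α

  -- In these four cases containment is first tested at the element 1, which `1 ∷_` puts into the
  -- shifted cut set and `inc` leaves out. Only a 1 that occurs on the left alone destroys
  -- containment; otherwise the shifted sets decide.
  ≤C-cut-cut : ((1 ∷ α) ≤C (1 ∷ β)) ≡ (α ≤C β)
  ≤C-cut-cut rewrite proj₁ (head-view i) | proj₁ (head-view j) = ⊑-suc-1 (S β) (S-positive i)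

  ≤C-inc-cut : (inc α ≤C (1 ∷ β)) ≡ (α ≤C β)
  ≤C-inc-cut rewrite proj₂ (head-view i) | proj₁ (head-view j) = ⊑-suc-1 (S β) (S-positive i)

  ≤C-inc-inc : (inc α ≤C inc β) ≡ (α ≤C β)
  ≤C-inc-inc rewrite proj₂ (head-view i) | proj₂ (head-view j) = ⊑-suc (S α) (S β)

  ≤C-cut-inc : ((1 ∷ α) ≤C inc β) ≡ false
  ≤C-cut-inc rewrite proj₁ (head-view i) | proj₂ (head-view j) | mem-1 (S-positive j) = refl

-- If f β is the coefficient of F_β in some element, this is its coefficient of M_γ, since F_β
-- contains M_γ exactly when β ≤ γ.
lower : ℕ → (Comp → ℚ) → Comp → ℚ
lower n f γ = ∑ (comps n) (λ β → [ β ≤C γ ]· f β)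

-- As γ cuts at 1, β is free to cut there or not, and both choices leave the same condition on the
-- rest. In `lower-ext` a cut of β at 1 is excluded, so only `inc β` survives.
lower-cut : ∀ {m x γ} f → IsComp (suc m) (x ∷ γ) →
            lower (suc (suc m)) f (1 ∷ x ∷ γ) ≡ lower (suc m) (λ β → f (1 ∷ β) + f (inc β)) (x ∷ γ)
lower-cut {m} {x} {γ} f i = trans (∑-comps m _) (trans (sym (∑-+ (comps (suc m)) _ _)) (∑-cong∈ (comps (suc m)) step))
  where
  step : ∀ {β} → β ∈ comps (suc m) →
         [ (1 ∷ β) ≤C (1 ∷ x ∷ γ) ]· f (1 ∷ β) + [ inc β ≤C (1 ∷ x ∷ γ) ]· f (inc β)
         ≡ [ β ≤C (x ∷ γ) ]· (f (1 ∷ β) + f (inc β))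
  step {β} β∈ with ∈comps⇒IsComp (suc m) β∈
  ... | j rewrite ≤C-cut-cut j i | ≤C-inc-cut j i with β ≤C (x ∷ γ)
  ...   | true  = refl
  ...   | false = refl

lower-ext : ∀ {m x γ} f → IsComp (suc m) (x ∷ γ) →
            lower (suc (suc m)) f (suc x ∷ γ) ≡ lower (suc m) (λ β → f (inc β)) (x ∷ γ)
lower-ext {m} {x} {γ} f i = trans (∑-comps m _) (trans (cong₂ _+_ (∑-zero (comps (suc m)) zeros) (∑-cong∈ (comps (suc m)) step)) (ℚP.+-identityˡ _))
  where
  zeros : ∀ {β} → β ∈ comps (suc m) → [ (1 ∷ β) ≤C (suc x ∷ γ) ]· f (1 ∷ β) ≡ 0ℚ
  zeros β∈ rewrite ≤C-cut-inc (∈comps⇒IsComp (suc m) β∈) i = refl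
  step : ∀ {β} → β ∈ comps (suc m) → [ inc β ≤C (suc x ∷ γ) ]· f (inc β) ≡ [ β ≤C (x ∷ γ) ]· f (inc β)
  step β∈ rewrite ≤C-inc-inc (∈comps⇒IsComp (suc m) β∈) i = refl

-- An element is determined by its M-coefficients. At γ without the cut 1, only f on compositions
-- without that cut enters, so induction settles those values. At γ with the cut 1, induction gives
-- equality of the sums f (1 ∷ β) + f (inc β), and the second summand, already settled, cancels.
lower-injective : ∀ n (f g : Comp → ℚ) → (∀ {γ} → IsComp n γ → lower n f γ ≡ lower n g γ) →
                  ∀ {γ} → IsComp n γ → f γ ≡ g γ
lower-injective zero f g e nil =
  trans (sym (ℚP.+-identityʳ (f []))) (trans (e nil) (ℚP.+-identityʳ (g [])))
lower-injective (suc zero) f g e one =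
  trans (sym (ℚP.+-identityʳ _)) (trans (e one) (ℚP.+-identityʳ _))
lower-injective (suc (suc m)) f g e {γ} = λ { (cut i) → cuts i ; (ext i) → exts i }
  where
  exts : ∀ {x γ} → IsComp (suc m) (x ∷ γ) → f (suc x ∷ γ) ≡ g (suc x ∷ γ)
  exts = lower-injective (suc m) (f ∘ inc) (g ∘ inc)
    (λ { {_ ∷ _} i → trans (sym (lower-ext f i)) (trans (e (ext i)) (lower-ext g i)) })
  cuts : ∀ {x γ} → IsComp (suc m) (x ∷ γ) → f (1 ∷ x ∷ γ) ≡ g (1 ∷ x ∷ γ)
  cuts {x} {γ} i = ∙-cancelʳ (f (suc x ∷ γ)) _ _
    (trans (lower-injective (suc m) _ _
             (λ { {_ ∷ _} j → trans (sym (lower-cut f j)) (trans (e (cut j)) (lower-cut g j)) }) i)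
           (cong (g (1 ∷ x ∷ γ) +_) (sym (exts i))))

lower-top : ∀ n f → lower n f (top n) ≡ f (top n)
lower-top zero          f = ℚP.+-identityʳ _
lower-top (suc zero)    f = ℚP.+-identityʳ _
lower-top (suc (suc n)) f = trans (lower-ext f (top-IsComp (suc n))) (lower-top (suc n) (f ∘ inc))

-- (1ⁿ) is the largest composition, so every β contributes; this is how row sums are read off.
-- Dually, in `lower-top`, only (n) lies below (n).
lower-ones : ∀ n f → lower n f (replicate n 1) ≡ ∑ (comps n) f
lower-ones zero          f = refl
lower-ones (suc zero)    f = refl
lower-ones (suc (suc n)) f = begin
  lower (suc (suc n)) f (replicate (suc (suc n)) 1)
    ≡⟨ lower-cut f (ones-IsComp (suc n)) ⟩
  lower (suc n) (λ β → f (1 ∷ β) + f (inc β)) (replicate (suc n) 1)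
    ≡⟨ lower-ones (suc n) _ ⟩
  ∑ (comps (suc n)) (λ β → f (1 ∷ β) + f (inc β))
    ≡⟨ ∑-+ (comps (suc n)) _ _ ⟩
  ∑ (comps (suc n)) (λ β → f (1 ∷ β)) + ∑ (comps (suc n)) (λ β → f (inc β))
    ≡⟨ ∑-comps n f ⟨
  ∑ (comps (suc (suc n))) f ∎
  where open ≡-Reasoning

-- Descent compositions of words

oneTo-suc : ∀ n → oneTo (suc n) ≡ 1 ∷ map suc (oneTo n)
oneTo-suc zero    = refl
oneTo-suc (suc n) = begin
  oneTo (suc n) ++ suc (suc n) ∷ []               ≡⟨ cong (_++ suc (suc n) ∷ []) (oneTo-suc n) ⟩
  1 ∷ map suc (oneTo n) ++ map suc (suc n ∷ [])   ≡⟨ cong (1 ∷_) (map-++ suc (oneTo n) _) ⟨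
  1 ∷ map suc (oneTo (suc n))                     ∎
  where open ≡-Reasoning

oneTo-positive : ∀ n → Positive (oneTo n)
oneTo-positive zero    = []
oneTo-positive (suc n) = AllP.++⁺ (oneTo-positive n) (z<s ∷ [])

diffs : List ℕ → List ℕ
diffs []           = []
diffs (a ∷ [])     = []
diffs (a ∷ b ∷ bs) = (b ∸ a) ∷ diffs (b ∷ bs)

diffs-unique : ∀ (f : List ℕ → List ℕ) → f [] ≡ [] → (∀ a → f (a ∷ []) ≡ []) →
               (∀ a b bs → f (a ∷ b ∷ bs) ≡ (b ∸ a) ∷ f (b ∷ bs)) → ∀ zs → f zs ≡ diffs zs
diffs-unique f p q r []           = p
diffs-unique f p q r (x ∷ [])     = q x
diffs-unique f p q r (x ∷ y ∷ zs) = trans (r x y zs) (cong (y ∸ x ∷_) (diffs-unique f p q r (y ∷ zs)))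

-- The underscore stands for a private function of Defs, which is not nameable here and is recovered
-- by unification (likewise in upto-is and indexOf-is).
mutual
  co-diffs : ∀ m xs → co (suc m) xs ≡ diffs (0 ∷ xs ++ (suc m ∷ []))
  -- With the argument abstracted to a variable, the goal determines the unnamed function.
  co-diffs m xs with 0 List.∷ xs ++ (suc m List.∷ List.[])
  ... | zs = diffs-is zs

  diffs-is : ∀ zs → _ ≡ diffs zs
  diffs-is = diffs-unique _ refl (λ _ → refl) (λ _ _ _ → refl)

diffs-suc : ∀ xs → diffs (map suc xs) ≡ diffs xs
diffs-suc []           = refl
diffs-suc (x ∷ [])     = refl
diffs-suc (x ∷ y ∷ xs) = cong (y ∸ x ∷_) (diffs-suc (y ∷ xs))

diffs-0-suc : ∀ x xs → diffs (0 ∷ map suc (x ∷ xs)) ≡ inc (diffs (0 ∷ x ∷ xs))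
diffs-0-suc x xs = cong (suc x ∷_) (diffs-suc (x ∷ xs))

co-cut : ∀ m xs → co (suc (suc m)) (1 ∷ map suc xs) ≡ 1 ∷ co (suc m) xs
co-cut m xs = begin
  co (suc (suc m)) (1 ∷ map suc xs)                   ≡⟨ co-diffs (suc m) (1 ∷ map suc xs) ⟩
  1 ∷ diffs (1 ∷ map suc xs ++ map suc (suc m ∷ [])) ≡⟨ cong (λ zs → 1 ∷ diffs (1 ∷ zs)) (map-++ suc xs _) ⟨
  1 ∷ diffs (map suc (0 ∷ xs ++ (suc m ∷ [])))        ≡⟨ cong (1 ∷_) (diffs-suc (0 ∷ xs ++ (suc m ∷ []))) ⟩
  1 ∷ diffs (0 ∷ xs ++ (suc m ∷ []))                  ≡⟨ cong (1 ∷_) (co-diffs m xs) ⟨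
  1 ∷ co (suc m) xs                                   ∎
  where open ≡-Reasoning

co-ext : ∀ m xs → co (suc (suc m)) (map suc xs) ≡ inc (co (suc m) xs)
co-ext m xs = begin
  co (suc (suc m)) (map suc xs)                   ≡⟨ co-diffs (suc m) (map suc xs) ⟩
  diffs (0 ∷ map suc xs ++ map suc (suc m ∷ [])) ≡⟨ cong (λ zs → diffs (0 ∷ zs)) (map-++ suc xs _) ⟨
  diffs (0 ∷ map suc (xs ++ (suc m ∷ [])))       ≡⟨ shift xs ⟩
  inc (diffs (0 ∷ xs ++ (suc m ∷ [])))           ≡⟨ cong inc (co-diffs m xs) ⟨
  inc (co (suc m) xs)                            ∎
  where
  open ≡-Reasoning
  shift : ∀ xs → diffs (0 ∷ map suc (xs ++ (suc m ∷ []))) ≡ inc (diffs (0 ∷ xs ++ (suc m ∷ [])))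
  shift []       = refl
  shift (x ∷ xs) = diffs-0-suc x (xs ++ (suc m ∷ []))

select : (ℕ → Bool) → List ℕ → List ℕ
select b = filter (λ i → b i Bool.≟ true)

-- Places are counted from 1 and `at` has a default value at 0, so descent tests of a word and of
-- its tail agree only at positive places.
select-map-suc : ∀ (b b′ : ℕ → Bool) → (∀ j → b (suc (suc j)) ≡ b′ (suc j)) →
                 ∀ {xs} → Positive xs → select b (map suc xs) ≡ map suc (select b′ xs)
select-map-suc b b′ e [] = refl
select-map-suc b b′ e {suc x ∷ xs} (_ ∷ ps) rewrite e x with b′ (suc x)
... | true  = cong (suc (suc x) ∷_) (select-map-suc b b′ e ps)
... | false = select-map-suc b b′ e ps

descentAt : List ℕ → ℕ → Bool
descentAt w i = at w (suc i) <ᵇ at w i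

Des-∷ : ∀ a b w → Des (a ∷ b ∷ w) ≡ (if b <ᵇ a then 1 ∷ map suc (Des (b ∷ w)) else map suc (Des (b ∷ w)))
Des-∷ a b w = trans (cong (select (descentAt (a ∷ b ∷ w))) (oneTo-suc (length w))) first
  where
  rest : select (descentAt (a ∷ b ∷ w)) (map suc (oneTo (length w))) ≡ map suc (Des (b ∷ w))
  rest = select-map-suc (descentAt (a ∷ b ∷ w)) (descentAt (b ∷ w)) (λ _ → refl) (oneTo-positive (length w))
  first : select (descentAt (a ∷ b ∷ w)) (1 ∷ map suc (oneTo (length w)))
          ≡ (if b <ᵇ a then 1 ∷ map suc (Des (b ∷ w)) else map suc (Des (b ∷ w)))
  first with b <ᵇ a
  ... | true  = cong (1 ∷_) rest
  ... | false = rest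

-- The first two letters alone decide whether 1 is a descent, so `D` grows by the same two
-- constructors as `IsComp`.
D-∷ : ∀ a b w → D (a ∷ b ∷ w) ≡ (if b <ᵇ a then 1 ∷ D (b ∷ w) else inc (D (b ∷ w)))
D-∷ a b w = trans (cong (co (suc (suc (length w)))) (Des-∷ a b w)) split
  where
  split : co (suc (suc (length w))) (if b <ᵇ a then 1 ∷ map suc (Des (b ∷ w)) else map suc (Des (b ∷ w)))
          ≡ (if b <ᵇ a then 1 ∷ D (b ∷ w) else inc (D (b ∷ w)))
  split with b <ᵇ a
  ... | true  = co-cut (length w) (Des (b ∷ w))
  ... | false = co-ext (length w) (Des (b ∷ w))

D-IsComp : ∀ w → IsComp (length w) (D w)
D-IsComp []          = nil
D-IsComp (a ∷ [])    = one
D-IsComp (a ∷ b ∷ w) = subst (IsComp (suc (suc (length w)))) (sym (D-∷ a b w)) (split (D-IsComp (b ∷ w)))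
  where
  cut′ : ∀ {α m} → IsComp (suc m) α → IsComp (suc (suc m)) (1 ∷ α)
  cut′ {_ ∷ _} i = cut i
  ext′ : ∀ {α m} → IsComp (suc m) α → IsComp (suc (suc m)) (inc α)
  ext′ {_ ∷ _} i = ext i
  split : IsComp (suc (length w)) (D (b ∷ w)) →
          IsComp (suc (suc (length w))) (if b <ᵇ a then 1 ∷ D (b ∷ w) else inc (D (b ∷ w)))
  split i with b <ᵇ a
  ... | true  = cut′ i
  ... | false = ext′ i

-- F_{D(w)} is the sum of M_β over β ∈ E w.
E : List ℕ → List Comp
E []          = [] ∷ []
E (a ∷ [])    = (1 ∷ []) ∷ []
E (a ∷ b ∷ w) = map (1 ∷_) (E (b ∷ w)) ++ (if b <ᵇ a then [] else map inc (E (b ∷ w)))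

infixr 6.5 ⟨_↗_⟩_

-- The indicator of a ≤ b, expressed by the descent test `b <ᵇ a` so that it splits together with
-- `D` and `E`.
⟨_↗_⟩_ : ℕ → ℕ → ℚ → ℚ
⟨ a ↗ b ⟩ q = if b <ᵇ a then 0ℚ else q

∑-E-∷ : ∀ a b w f → ∑ (E (a ∷ b ∷ w)) f ≡
        ∑ (E (b ∷ w)) (f ∘ (1 ∷_)) + ⟨ a ↗ b ⟩ ∑ (E (b ∷ w)) (f ∘ inc)
∑-E-∷ a b w f = trans (∑-++ (map (1 ∷_) (E (b ∷ w))) _ f) (cong₂ _+_ (∑-map _ (E (b ∷ w)) f) split)
  where
  split : ∑ (if b <ᵇ a then [] else map inc (E (b ∷ w))) f ≡ ⟨ a ↗ b ⟩ ∑ (E (b ∷ w)) (f ∘ inc)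
  split with b <ᵇ a
  ... | true  = refl
  ... | false = ∑-map inc (E (b ∷ w)) f

-- Both sides first decide whether β cuts at 1. A descent at 1 forces that cut, and otherwise both
-- choices are allowed; `≤C` treats the rest in the same way in either case.
∑-E : ∀ w f → ∑ (E w) f ≡ ∑ (comps (length w)) (λ β → [ D w ≤C β ]· f β)
∑-E []          f = refl
∑-E (a ∷ [])    f = refl
∑-E (a ∷ b ∷ w) f = begin
  ∑ (E (a ∷ b ∷ w)) f
    ≡⟨ ∑-E-∷ a b w f ⟩
  ∑ (E (b ∷ w)) (f ∘ (1 ∷_)) + ⟨ a ↗ b ⟩ ∑ (E (b ∷ w)) (f ∘ inc)
    ≡⟨ cong₂ (λ p q → p + ⟨ a ↗ b ⟩ q) (∑-E (b ∷ w) (f ∘ (1 ∷_))) (∑-E (b ∷ w) (f ∘ inc)) ⟩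
  ∑ cs (λ β → [ D (b ∷ w) ≤C β ]· f (1 ∷ β)) + ⟨ a ↗ b ⟩ ∑ cs (λ β → [ D (b ∷ w) ≤C β ]· f (inc β))
    ≡⟨ split ⟩
  ∑ cs (λ β → [ Dab ≤C (1 ∷ β) ]· f (1 ∷ β)) + ∑ cs (λ β → [ Dab ≤C inc β ]· f (inc β))
    ≡⟨ ∑-comps (length w) _ ⟨
  ∑ (comps (suc (suc (length w)))) (λ β → [ Dab ≤C β ]· f β)
    ≡⟨ cong (λ α → ∑ (comps (suc (suc (length w)))) (λ β → [ α ≤C β ]· f β)) (D-∷ a b w) ⟨
  ∑ (comps (suc (suc (length w)))) (λ β → [ D (a ∷ b ∷ w) ≤C β ]· f β) ∎
  where
  open ≡-Reasoning
  cs : List Comp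
  cs = comps (suc (length w))
  Dab : Comp
  Dab = if b <ᵇ a then 1 ∷ D (b ∷ w) else inc (D (b ∷ w))
  ic : ∀ {β} → β ∈ cs → IsComp (suc (length w)) β
  ic = ∈comps⇒IsComp (suc (length w))
  split : ∑ cs (λ β → [ D (b ∷ w) ≤C β ]· f (1 ∷ β)) + ⟨ a ↗ b ⟩ ∑ cs (λ β → [ D (b ∷ w) ≤C β ]· f (inc β))
        ≡ ∑ cs (λ β → [ Dab ≤C (1 ∷ β) ]· f (1 ∷ β)) + ∑ cs (λ β → [ Dab ≤C inc β ]· f (inc β))
  split with b <ᵇ a
  ... | true  = cong₂ _+_
    (∑-cong∈ cs (λ {β} β∈ → cong (λ t → [ t ]· f (1 ∷ β)) (sym (≤C-cut-cut (D-IsComp (b ∷ w)) (ic β∈)))))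
    (sym (∑-zero cs (λ {β} β∈ → cong (λ t → [ t ]· f (inc β)) (≤C-cut-inc (D-IsComp (b ∷ w)) (ic β∈)))))
  ... | false = cong₂ _+_
    (∑-cong∈ cs (λ {β} β∈ → cong (λ t → [ t ]· f (1 ∷ β)) (sym (≤C-inc-cut (D-IsComp (b ∷ w)) (ic β∈)))))
    (∑-cong∈ cs (λ {β} β∈ → cong (λ t → [ t ]· f (inc β)) (sym (≤C-inc-inc (D-IsComp (b ∷ w)) (ic β∈)))))

-- Coproduct and product on the monomial basis

splits : Comp → List (Comp × Comp)
splits []      = ([] , []) ∷ []
splits (x ∷ α) = ([] , x ∷ α) ∷ map (λ p → x ∷ proj₁ p , proj₂ p) (splits α)

upto-unique : ∀ (f : ℕ → List ℕ) → f 0 ≡ 0 ∷ [] → (∀ n → f (suc n) ≡ f n ++ (suc n ∷ [])) →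
              ∀ n → f n ≡ 0 ∷ oneTo n
upto-unique f p q zero    = p
upto-unique f p q (suc n) = trans (q n) (cong (_++ (suc n ∷ [])) (upto-unique f p q n))

mutual
  ΔM-oneTo : ∀ α → ΔM α ≡ map (λ i → (1ℚ , take i α , drop i α)) (0 ∷ oneTo (length α))
  ΔM-oneTo α with length α
  ... | k = cong (map (λ i → (1ℚ , take i α , drop i α))) (upto-is k)

  upto-is : ∀ k → _ ≡ 0 ∷ oneTo k
  upto-is = upto-unique _ refl (λ _ → refl)

take-drop-splits : ∀ α → map (λ i → (take i α , drop i α)) (0 ∷ oneTo (length α)) ≡ splits α
take-drop-splits []      = refl
take-drop-splits (x ∷ α) = cong (([] , x ∷ α) ∷_) (begin
  map (λ i → (take i (x ∷ α) , drop i (x ∷ α))) (oneTo (suc (length α)))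
    ≡⟨ cong (map _) (oneTo-suc (length α)) ⟩
  map (λ i → (take i (x ∷ α) , drop i (x ∷ α))) (map suc (0 ∷ oneTo (length α)))
    ≡⟨ map-∘ (0 ∷ oneTo (length α)) ⟨
  map (λ i → (x ∷ take i α , drop i α)) (0 ∷ oneTo (length α))
    ≡⟨ map-∘ (0 ∷ oneTo (length α)) ⟩
  map (λ p → x ∷ proj₁ p , proj₂ p) (map (λ i → (take i α , drop i α)) (0 ∷ oneTo (length α)))
    ≡⟨ cong (map _) (take-drop-splits α) ⟩
  map (λ p → x ∷ proj₁ p , proj₂ p) (splits α) ∎)
  where open ≡-Reasoning

ΔM-splits : ∀ α → ΔM α ≡ map (1ℚ ,_) (splits α)
ΔM-splits α = trans (ΔM-oneTo α) (trans (map-∘ (0 ∷ oneTo (length α))) (cong (map (1ℚ ,_)) (take-drop-splits α)))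

splits-++ : ∀ {α p} → p ∈ splits α → proj₁ p ++ proj₂ p ≡ α
splits-++ {[]}    (here refl) = refl
splits-++ {x ∷ α} (here refl) = refl
splits-++ {x ∷ α} (there p∈) with ∈-map⁻ _ p∈
... | _ , q∈ , refl = cong (x ∷_) (splits-++ q∈)

size-++ : ∀ α β → size (α ++ β) ≡ size α ℕ.+ size β
size-++ []      β = refl
size-++ (x ∷ α) β = trans (cong (x ℕ.+_) (size-++ α β)) (sym (ℕP.+-assoc x (size α) (size β)))

coef-scale : ∀ q v γ → coef (scale q v) γ ≡ q * coef v γ
coef-scale q v γ = begin
  ∑ (scale q v) (λ p → [ proj₂ p == γ ]· proj₁ p) ≡⟨ ∑-map _ v _ ⟩
  ∑ v (λ p → [ proj₂ p == γ ]· q * proj₁ p)       ≡⟨ ∑-cong v (λ p → *-[]· (proj₂ p == γ) q (proj₁ p)) ⟨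
  ∑ v (λ p → q * ([ proj₂ p == γ ]· proj₁ p))     ≡⟨ *-∑ q v _ ⟨
  q * coef v γ ∎
  where open ≡-Reasoning

coef-applyM : ∀ Φ {n α γ} → size α ≡ n → IsComp n γ → coef (applyM Φ α) γ ≡ Φ α γ
coef-applyM Φ {α = α} refl i =
  trans (∑-map _ (comps (size α)) _) (∑-δ (Φ α) (comps-unique (size α)) (IsComp⇒∈comps i))

coef-apply : ∀ Φ v γ → coef (apply Φ v) γ ≡ ∑ v (λ p → proj₁ p * coef (applyM Φ (proj₂ p)) γ)
coef-apply Φ v γ = trans (∑-concatMap _ v _) (∑-cong v (λ p → coef-scale (proj₁ p) (applyM Φ (proj₂ p)) γ))

qsh-size : ∀ α β {γ} → γ ∈ qsh α β → size γ ≡ size α ℕ.+ size β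
qsh-size []      β (here refl) = refl
qsh-size (x ∷ α) [] (here refl) = sym (ℕP.+-identityʳ _)
qsh-size (x ∷ α) (y ∷ β) γ∈ with ∈-++⁻ (map (x ∷_) (qsh α (y ∷ β))) γ∈
... | inj₁ p with _ , q , refl ← ∈-map⁻ (x ∷_) p =
  trans (cong (x ℕ.+_) (qsh-size α (y ∷ β) q)) (sym (ℕP.+-assoc x (size α) _))
... | inj₂ p with ∈-++⁻ (map (y ∷_) (qsh (x ∷ α) β)) p
...   | inj₁ q with _ , r , refl ← ∈-map⁻ (y ∷_) q =
  trans (cong (y ℕ.+_) (qsh-size (x ∷ α) β r)) (x∙yz≈y∙xz y (x ℕ.+ size α) (size β))
...   | inj₂ q with _ , r , refl ← ∈-map⁻ ((x ℕ.+ y) ∷_) q =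
  trans (cong (x ℕ.+ y ℕ.+_) (qsh-size α β r)) (interchange x y (size α) (size β))

qsh-nonempty : ∀ α β → [] ∈ qsh α β → (α ≡ []) × (β ≡ [])
qsh-nonempty []      []       _ = refl , refl
qsh-nonempty []      (y ∷ β) (here ())
qsh-nonempty []      (y ∷ β) (there ())
qsh-nonempty (x ∷ α) []      (here ())
qsh-nonempty (x ∷ α) []      (there ())
qsh-nonempty (x ∷ α) (y ∷ β) γ∈ with ∈-++⁻ (map (x ∷_) (qsh α (y ∷ β))) γ∈
... | inj₁ p with _ , _ , () ← ∈-map⁻ (x ∷_) p
... | inj₂ p with ∈-++⁻ (map (y ∷_) (qsh (x ∷ α) β)) p
...   | inj₁ q with _ , _ , () ← ∈-map⁻ (y ∷_) q
...   | inj₂ q with _ , _ , () ← ∈-map⁻ ((x ℕ.+ y) ∷_) q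

∑-∷-top : ∀ s n (L : List Comp) q → [] ∉ L →
          ∑ (map (s ∷_) L) (λ γ → [ γ == top n ]· q) ≡ 0ℚ
∑-∷-top s n L q []∉ = trans (∑-map (s ∷_) L _) (∑-zero L (λ {γ} γ∈ → cong (λ b → [ b ]· q) (==-≢ (ne n γ∈))))
  where
  ne : ∀ n {γ} → γ ∈ L → s ∷ γ ≢ top n
  ne (suc n) γ∈ e = []∉ (subst (_∈ L) (∷-injectiveʳ e) γ∈)

two-parts≢top : ∀ n {x y α} → x ∷ y ∷ α ≢ top n
two-parts≢top zero    ()
two-parts≢top (suc n) ()

singleton-top : ∀ {x} → 0 ℕ.< x → x ∷ [] ≡ top x
singleton-top {suc x} _ = refl

-- A quasi-shuffle of two nonempty compositions has a single part only if both have a single part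
-- and these are merged, which happens once. Hence taking the coefficient of M_(n) is
-- multiplicative. An empty factor fits in because `top 0` is the empty composition.
∑-qsh-top : ∀ {α β} → Positive α → Positive β → ∀ q →
            ∑ (qsh α β) (λ γ → [ γ == top (size α ℕ.+ size β) ]· q)
            ≡ [ α == top (size α) ]· [ β == top (size β) ]· q
∑-qsh-top {[]}    {β}  _ _ q = ℚP.+-identityʳ _
∑-qsh-top {x ∷ α} {[]} _ _ q rewrite ℕP.+-identityʳ (x ℕ.+ size α) = ℚP.+-identityʳ _
∑-qsh-top {x ∷ α} {y ∷ β} (px ∷ _) (py ∷ _) q = begin
  ∑ (qsh (x ∷ α) (y ∷ β)) f
    ≡⟨ ∑-++ (map (x ∷_) (qsh α (y ∷ β))) _ f ⟩
  ∑ (map (x ∷_) (qsh α (y ∷ β))) f + ∑ (map (y ∷_) (qsh (x ∷ α) β) ++ map ((x ℕ.+ y) ∷_) (qsh α β)) f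
    ≡⟨ cong₂ _+_ (∑-∷-top x n (qsh α (y ∷ β)) q (λ p → contradiction (proj₂ (qsh-nonempty α _ p)) λ ()))
                 (∑-++ (map (y ∷_) (qsh (x ∷ α) β)) _ f) ⟩
  0ℚ + (∑ (map (y ∷_) (qsh (x ∷ α) β)) f + ∑ (map ((x ℕ.+ y) ∷_) (qsh α β)) f)
    ≡⟨ ℚP.+-identityˡ _ ⟩
  ∑ (map (y ∷_) (qsh (x ∷ α) β)) f + ∑ (map ((x ℕ.+ y) ∷_) (qsh α β)) f
    ≡⟨ cong (_+ ∑ (map ((x ℕ.+ y) ∷_) (qsh α β)) f)
          (∑-∷-top y n (qsh (x ∷ α) β) q (λ p → contradiction (proj₁ (qsh-nonempty (x ∷ α) β p)) λ ())) ⟩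
  0ℚ + ∑ (map ((x ℕ.+ y) ∷_) (qsh α β)) f
    ≡⟨ ℚP.+-identityˡ _ ⟩
  ∑ (map ((x ℕ.+ y) ∷_) (qsh α β)) f
    ≡⟨ merged α β ⟩
  [ (x ∷ α) == top (size (x ∷ α)) ]· [ (y ∷ β) == top (size (y ∷ β)) ]· q ∎
  where
  open ≡-Reasoning
  n : ℕ
  n = size (x ∷ α) ℕ.+ size (y ∷ β)
  f : Comp → ℚ
  f γ = [ γ == top n ]· q
  merged : ∀ α β → ∑ (map ((x ℕ.+ y) ∷_) (qsh α β)) (λ γ → [ γ == top (size (x ∷ α) ℕ.+ size (y ∷ β)) ]· q)
           ≡ [ (x ∷ α) == top (size (x ∷ α)) ]· [ (y ∷ β) == top (size (y ∷ β)) ]· q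
  merged [] [] rewrite ℕP.+-identityʳ x | ℕP.+-identityʳ y
    | ==-≡ (singleton-top px) | ==-≡ (singleton-top py)
    | ==-≡ (singleton-top (ℕP.m≤n⇒m≤n+o y px)) = ℚP.+-identityʳ q
  merged [] (z ∷ β) = trans (∑-∷-top (x ℕ.+ y) (x ℕ.+ 0 ℕ.+ size (y ∷ z ∷ β)) (qsh [] (z ∷ β)) q (λ p → contradiction (proj₂ (qsh-nonempty [] (z ∷ β) p)) λ ()))
    (sym (trans (cong (λ b → [ (x ∷ []) == top (x ℕ.+ 0) ]· [ b ]· q) (==-≢ (two-parts≢top (size (y ∷ z ∷ β)) {y})))
         ([]·-0 ((x ∷ []) == top (x ℕ.+ 0)))))
  merged (z ∷ α) β = trans (∑-∷-top (x ℕ.+ y) (size (x ∷ z ∷ α) ℕ.+ size (y ∷ β)) (qsh (z ∷ α) β) q (λ p → contradiction (proj₁ (qsh-nonempty (z ∷ α) β p)) λ ()))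
    (sym (cong (λ b → [ b ]· [ (y ∷ β) == top (size (y ∷ β)) ]· q) (==-≢ (two-parts≢top (size (x ∷ z ∷ α)) {x}))))

-- The term M_(g) ⊗ M_γ occurs only in the coproduct of M at (g)·γ, and there once, because a
-- concatenation has only one cut with a given left factor.
∑-splits-singleton : ∀ g γ δ q →
  ∑ (splits δ) (λ p → [ (proj₁ p == (g ∷ [])) ∧ (proj₂ p == γ) ]· q) ≡ [ δ == (g ∷ γ) ]· q
∑-splits-singleton g γ []      q = ℚP.+-identityʳ 0ℚ
∑-splits-singleton g γ (x ∷ δ) q =
  trans (ℚP.+-identityˡ _) (trans (∑-map _ (splits δ) _) (go δ))
  where
  later : ∀ y δ → ∑ (map (λ p → y ∷ proj₁ p , proj₂ p) (splits δ))
                    (λ p → [ ((x ∷ proj₁ p) == (g ∷ [])) ∧ (proj₂ p == γ) ]· q) ≡ 0ℚ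
  later y δ = trans (∑-map _ (splits δ) _) (∑-zero (splits δ) (λ {p} _ →
    cong (λ b → [ b ∧ (proj₂ p == γ) ]· q) (==-≢ {x ∷ y ∷ proj₁ p} {g ∷ []} (λ ()))))
  first : ∀ δ → [ ((x ∷ []) == (g ∷ [])) ∧ (δ == γ) ]· q ≡ [ (x ∷ δ) == (g ∷ γ) ]· q
  first δ with x ℕ.≟ g
  ... | no _ = refl
  ... | yes refl with ≡-dec ℕ._≟_ δ γ
  ...   | yes _ = refl
  ...   | no _  = refl
  go : ∀ δ → ∑ (splits δ) (λ p → [ ((x ∷ proj₁ p) == (g ∷ [])) ∧ (proj₂ p == γ) ]· q) ≡ [ (x ∷ δ) == (g ∷ γ) ]· q
  go []      = trans (ℚP.+-identityʳ _) (first [])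
  go (y ∷ δ) = trans (cong₂ _+_ (first (y ∷ δ)) (later y δ)) (ℚP.+-identityʳ _)

-- The character of a Hopf endomorphism

module Hopf (Φ : Endo) (hopf : IsHopfEndo Φ) where
  open IsHopfEndo hopf

  -- The multiplicative functional on 𝒬 that sends f to the coefficient of M_(n) in Φ(f), for f of degree n.
  χ : Comp → ℚ
  χ α = Φ α (top (size α))

  χ-[] : χ [] ≡ 1ℚ
  χ-[] = unit

  -- Compatibility with the product, read at the coefficient of M_(m+k). In the product of the
  -- images only the terms M_(m) and M_(k) reach it, by `∑-qsh-top`.
  χ-mult : ∀ {α β} → Positive α → Positive β → ∑ (qsh α β) χ ≡ χ α * χ β
  χ-mult {α} {β} pα pβ = begin
    ∑ (qsh α β) χ
      ≡⟨ lhs ⟨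
    coef (apply Φ (mulLC (M α) (M β))) (top n)
      ≡⟨ mult {m} {k} (IsComp⇒∈comps (positive⇒IsComp pα)) (IsComp⇒∈comps (positive⇒IsComp pβ)) (top n) ⟩
    coef (mulLC (applyM Φ α) (applyM Φ β)) (top n)
      ≡⟨ rhs ⟩
    χ α * χ β ∎
    where
    open ≡-Reasoning
    n m k : ℕ
    m = size α
    k = size β
    n = m ℕ.+ k
    lhs : coef (apply Φ (mulLC (M α) (M β))) (top n) ≡ ∑ (qsh α β) χ
    lhs = begin
      coef (apply Φ (mulLC (M α) (M β))) (top n)
        ≡⟨ coef-apply Φ (mulLC (M α) (M β)) (top n) ⟩
      ∑ (mulLC (M α) (M β)) (λ p → proj₁ p * coef (applyM Φ (proj₂ p)) (top n))
        ≡⟨ trans (∑-concatMap (λ p → concatMap (λ q → map (λ γ → (proj₁ p * proj₁ q , γ)) (qsh (proj₂ p) (proj₂ q))) (M β)) (M α) _)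
                 (ℚP.+-identityʳ _) ⟩
      ∑ (concatMap (λ q → map (λ γ → (1ℚ * proj₁ q , γ)) (qsh α (proj₂ q))) (M β)) (λ p → proj₁ p * coef (applyM Φ (proj₂ p)) (top n))
        ≡⟨ trans (∑-concatMap (λ q → map (λ γ → (1ℚ * proj₁ q , γ)) (qsh α (proj₂ q))) (M β) _)
                 (ℚP.+-identityʳ _) ⟩
      ∑ (map (λ γ → (1ℚ * 1ℚ , γ)) (qsh α β)) (λ p → proj₁ p * coef (applyM Φ (proj₂ p)) (top n))
        ≡⟨ ∑-map _ (qsh α β) _ ⟩
      ∑ (qsh α β) (λ γ → (1ℚ * 1ℚ) * coef (applyM Φ γ) (top n))
        ≡⟨ ∑-cong∈ (qsh α β) (λ {γ} γ∈ → trans (ℚP.*-identityˡ _)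
             (trans (coef-applyM Φ {n} {γ} (qsh-size α β γ∈) (top-IsComp n)) (cong (λ s → Φ γ (top s)) (sym (qsh-size α β γ∈))))) ⟩
      ∑ (qsh α β) χ ∎
    rhs : coef (mulLC (applyM Φ α) (applyM Φ β)) (top n) ≡ χ α * χ β
    rhs = begin
      coef (mulLC (applyM Φ α) (applyM Φ β)) (top n)
        ≡⟨ trans (∑-concatMap _ (applyM Φ α) _) (∑-map _ (comps m) _) ⟩
      ∑ (comps m) (λ α′ → ∑ (concatMap (λ q → map (λ γ → (Φ α α′ * proj₁ q , γ)) (qsh α′ (proj₂ q))) (applyM Φ β)) (λ p → [ proj₂ p == top n ]· proj₁ p))
        ≡⟨ ∑-cong (comps m) (λ α′ → trans (∑-concatMap (λ q → map (λ γ → (Φ α α′ * proj₁ q , γ)) (qsh α′ (proj₂ q))) (applyM Φ β) _) (∑-map _ (comps k) _)) ⟩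
      ∑ (comps m) (λ α′ → ∑ (comps k) (λ β′ → ∑ (map (λ γ → (Φ α α′ * Φ β β′ , γ)) (qsh α′ β′)) (λ p → [ proj₂ p == top n ]· proj₁ p)))
        ≡⟨ ∑-cong∈ (comps m) (λ {α′} α′∈ → ∑-cong∈ (comps k) (λ {β′} β′∈ → trans (∑-map _ (qsh α′ β′) _) (pick α′∈ β′∈ (Φ α α′ * Φ β β′)))) ⟩
      ∑ (comps m) (λ α′ → ∑ (comps k) (λ β′ → [ α′ == top m ]· [ β′ == top k ]· Φ α α′ * Φ β β′))
        ≡⟨ ∑-cong (comps m) (λ α′ → ∑-[]· (α′ == top m) (comps k) _) ⟩
      ∑ (comps m) (λ α′ → [ α′ == top m ]· ∑ (comps k) (λ β′ → [ β′ == top k ]· Φ α α′ * Φ β β′))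
        ≡⟨ ∑-δ _ (comps-unique m) (IsComp⇒∈comps (top-IsComp m)) ⟩
      ∑ (comps k) (λ β′ → [ β′ == top k ]· Φ α (top m) * Φ β β′)
        ≡⟨ ∑-δ _ (comps-unique k) (IsComp⇒∈comps (top-IsComp k)) ⟩
      χ α * χ β ∎
      where
      pick : ∀ {α′ β′} → α′ ∈ comps m → β′ ∈ comps k → ∀ q →
             ∑ (qsh α′ β′) (λ γ → [ γ == top n ]· q) ≡ [ α′ == top m ]· [ β′ == top k ]· q
      pick {α′} {β′} α′∈ β′∈ q =
        subst₂ (λ m k → ∑ (qsh α′ β′) (λ γ → [ γ == top (m ℕ.+ k) ]· q) ≡ [ α′ == top m ]· [ β′ == top k ]· q)
          (∈comps-size α′∈) (∈comps-size β′∈)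
          (∑-qsh-top (IsComp-positive (∈comps⇒IsComp m α′∈)) (IsComp-positive (∈comps⇒IsComp k β′∈)) q)

  -- Compatibility with the coproduct, read at the coefficient of M_(g+1) ⊗ M_γ. In the coproduct of
  -- Φ(M_α) it comes only from M at (g+1)·γ. On the other side Φ preserves degree, so only the
  -- splits of α with left factor of size g + 1 remain.
  χ-split : ∀ g {k n α γ} → IsComp n α → IsComp k γ → IsComp n (suc g ∷ γ) →
            Φ α (suc g ∷ γ) ≡ ∑ (splits α) (λ p → [ size (proj₁ p) ≡ᵇ suc g ]· χ (proj₁ p) * Φ (proj₂ p) γ)
  χ-split g {k} {n} {α} {γ} iα iγ i = begin
    Φ α (suc g ∷ γ)
      ≡⟨ rhs ⟨
    coef₂ (ΔLC (applyM Φ α)) (suc g ∷ []) γ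
      ≡⟨ comult {n} (IsComp⇒∈comps iα) (suc g ∷ []) γ ⟨
    coef₂ (apply⊗ Φ (ΔM α)) (suc g ∷ []) γ
      ≡⟨ lhs ⟩
    ∑ (splits α) (λ p → [ size (proj₁ p) ≡ᵇ suc g ]· χ (proj₁ p) * Φ (proj₂ p) γ) ∎
    where
    open ≡-Reasoning
    e₂ : ℚ × Comp × Comp → ℚ
    e₂ p = [ (proj₁ (proj₂ p) == (suc g ∷ [])) ∧ (proj₂ (proj₂ p) == γ) ]· proj₁ p
    rhs : coef₂ (ΔLC (applyM Φ α)) (suc g ∷ []) γ ≡ Φ α (suc g ∷ γ)
    rhs = begin
      ∑ (ΔLC (applyM Φ α)) e₂
        ≡⟨ trans (∑-concatMap _ (applyM Φ α) e₂) (∑-map _ (comps (size α)) _) ⟩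
      ∑ (comps (size α)) (λ δ → ∑ (map (λ t → (Φ α δ * proj₁ t , proj₂ t)) (ΔM δ)) e₂)
        ≡⟨ ∑-cong (comps (size α)) (λ δ → trans (∑-map _ (ΔM δ) e₂) (trans (cong (λ L → ∑ L (λ t → e₂ (Φ α δ * proj₁ t , proj₂ t))) (ΔM-splits δ)) (∑-map _ (splits δ) _))) ⟩
      ∑ (comps (size α)) (λ δ → ∑ (splits δ) (λ p → [ (proj₁ p == (suc g ∷ [])) ∧ (proj₂ p == γ) ]· Φ α δ * 1ℚ))
        ≡⟨ ∑-cong (comps (size α)) (λ δ → ∑-splits-singleton (suc g) γ δ (Φ α δ * 1ℚ)) ⟩
      ∑ (comps (size α)) (λ δ → [ δ == (suc g ∷ γ) ]· Φ α δ * 1ℚ)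
        ≡⟨ ∑-δ _ (comps-unique (size α)) (subst (λ m → (suc g ∷ γ) ∈ comps m) (sym (IsComp-size iα)) (IsComp⇒∈comps i)) ⟩
      Φ α (suc g ∷ γ) * 1ℚ
        ≡⟨ ℚP.*-identityʳ _ ⟩
      Φ α (suc g ∷ γ) ∎
    sizes : ∀ {s t} → (s , t) ∈ splits α → size s ≡ suc g → size t ≡ size γ
    sizes {s} {t} p∈ s≡ = ℕP.+-cancelˡ-≡ (size s) _ _ (begin
      size s ℕ.+ size t ≡⟨ size-++ s t ⟨
      size (s ++ t)     ≡⟨ cong size (splits-++ p∈) ⟩
      size α            ≡⟨ trans (IsComp-size iα) (sym (IsComp-size i)) ⟩
      suc g ℕ.+ size γ  ≡⟨ cong (ℕ._+ size γ) s≡ ⟨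
      size s ℕ.+ size γ ∎)
    inner : ∀ {s t} → (s , t) ∈ splits α →
            ∑ (comps (size s)) (λ b → ∑ (comps (size t)) (λ h → e₂ (1ℚ * Φ s b * Φ t h , b , h)))
            ≡ [ size s ≡ᵇ suc g ]· χ s * Φ t γ
    inner {s} {t} p∈ = begin
      ∑ (comps (size s)) (λ b → ∑ (comps (size t)) (λ h → e₂ (1ℚ * Φ s b * Φ t h , b , h)))
        ≡⟨ ∑-cong (comps (size s)) (λ b → trans (∑-cong (comps (size t)) (λ h → []·-∧ (b == (suc g ∷ [])) (h == γ) _)) (∑-[]· (b == (suc g ∷ [])) (comps (size t)) _)) ⟩
      ∑ (comps (size s)) (λ b → [ b == (suc g ∷ []) ]· ∑ (comps (size t)) (λ h → [ h == γ ]· 1ℚ * Φ s b * Φ t h))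
        ≡⟨ split ⟩
      [ size s ≡ᵇ suc g ]· χ s * Φ t γ ∎
      where
      split : ∑ (comps (size s)) (λ b → [ b == (suc g ∷ []) ]· ∑ (comps (size t)) (λ h → [ h == γ ]· 1ℚ * Φ s b * Φ t h))
              ≡ [ size s ≡ᵇ suc g ]· χ s * Φ t γ
      split with size s ≡ᵇ suc g in eq
      ... | true = begin
        ∑ (comps (size s)) (λ b → [ b == (suc g ∷ []) ]· ∑ (comps (size t)) (λ h → [ h == γ ]· 1ℚ * Φ s b * Φ t h))
          ≡⟨ ∑-δ _ (comps-unique (size s)) (subst (λ m → (suc g ∷ []) ∈ comps m) (sym s≡) (IsComp⇒∈comps (top-IsComp (suc g)))) ⟩
        ∑ (comps (size t)) (λ h → [ h == γ ]· 1ℚ * Φ s (suc g ∷ []) * Φ t h)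
          ≡⟨ ∑-δ _ (comps-unique (size t)) (subst (λ m → γ ∈ comps m) (trans (sym (IsComp-size iγ)) (sym (sizes p∈ s≡))) (IsComp⇒∈comps iγ)) ⟩
        1ℚ * Φ s (suc g ∷ []) * Φ t γ
          ≡⟨ cong (_* Φ t γ) (ℚP.*-identityˡ (Φ s (suc g ∷ []))) ⟩
        Φ s (suc g ∷ []) * Φ t γ
          ≡⟨ cong (λ m → Φ s (top m) * Φ t γ) s≡ ⟨
        χ s * Φ t γ ∎
        where
        s≡ : size s ≡ suc g
        s≡ = ℕP.≡ᵇ⇒≡ (size s) (suc g) (subst T (sym eq) _)
      ... | false = ∑-zero (comps (size s)) (λ {b} b∈ → cong (λ z → [ z ]· ∑ (comps (size t)) (λ h → [ h == γ ]· 1ℚ * Φ s b * Φ t h))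
              (==-≢ (λ b≡ → subst T eq (ℕP.≡⇒≡ᵇ (size s) (suc g) (trans (sym (∈comps-size b∈)) (trans (cong size b≡) (ℕP.+-identityʳ (suc g))))))))
    lhs : coef₂ (apply⊗ Φ (ΔM α)) (suc g ∷ []) γ ≡ ∑ (splits α) (λ p → [ size (proj₁ p) ≡ᵇ suc g ]· χ (proj₁ p) * Φ (proj₂ p) γ)
    lhs = begin
      ∑ (apply⊗ Φ (ΔM α)) e₂
        ≡⟨ ∑-concatMap _ (ΔM α) e₂ ⟩
      ∑ (ΔM α) both
        ≡⟨ trans (cong (λ L → ∑ L both) (ΔM-splits α)) (∑-map (1ℚ ,_) (splits α) both) ⟩
      ∑ (splits α) (λ p → ∑ (concatMap (λ b → map (λ h → (1ℚ * proj₁ b * proj₁ h , proj₂ b , proj₂ h)) (applyM Φ (proj₂ p))) (applyM Φ (proj₁ p))) e₂)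
        ≡⟨ ∑-cong (splits α) (λ p → trans (∑-concatMap _ (applyM Φ (proj₁ p)) e₂) (trans (∑-map _ (comps (size (proj₁ p))) _)
             (∑-cong (comps (size (proj₁ p))) (λ b → trans (∑-map _ (applyM Φ (proj₂ p)) e₂) (∑-map _ (comps (size (proj₂ p))) _))))) ⟩
      ∑ (splits α) (λ p → ∑ (comps (size (proj₁ p))) (λ b → ∑ (comps (size (proj₂ p))) (λ h → e₂ (1ℚ * Φ (proj₁ p) b * Φ (proj₂ p) h , b , h))))
        ≡⟨ ∑-cong∈ (splits α) inner ⟩
      ∑ (splits α) (λ p → [ size (proj₁ p) ≡ᵇ suc g ]· χ (proj₁ p) * Φ (proj₂ p) γ) ∎
      where
      both : ℚ × Comp × Comp → ℚ
      both p = ∑ (concatMap (λ b → map (λ h → (proj₁ p * proj₁ b * proj₁ h , proj₂ b , proj₂ h))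
                                       (applyM Φ (proj₂ (proj₂ p))))
                            (applyM Φ (proj₁ (proj₂ p)))) e₂

E-IsComp : ∀ w {β} → β ∈ E w → IsComp (length w) β
E-IsComp []       (here refl) = nil
E-IsComp (a ∷ []) (here refl) = one
E-IsComp (a ∷ b ∷ w) β∈ = extend (E-IsComp (b ∷ w)) (∈-++⁻ (map (1 ∷_) (E (b ∷ w))) β∈)
  where
  extend : (∀ {β} → β ∈ E (b ∷ w) → IsComp (suc (length w)) β) →
           ∀ {β} → β ∈ map (1 ∷_) (E (b ∷ w)) ⊎ β ∈ (if b <ᵇ a then [] else map inc (E (b ∷ w))) →
           IsComp (suc (suc (length w))) β
  extend ih (inj₁ p) with ∈-map⁻ (1 ∷_) p
  ... | [] , q , refl with () ← ih q
  ... | _ ∷ _ , q , refl = cut (ih q)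
  extend ih (inj₂ p) with b <ᵇ a
  ... | false with ∈-map⁻ inc p
  ...   | [] , q , refl with () ← ih q
  ...   | _ ∷ _ , q , refl = ext (ih q)

-- Coproduct of fundamental functions

-- For functionals f and h given on the M-basis, this is f ⊗ h applied to the part of the coproduct
-- of M_β whose left factor has degree g.
cutAt : ℕ → (Comp → ℚ) → (Comp → ℚ) → Comp → ℚ
cutAt g f h β = ∑ (splits β) (λ p → [ size (proj₁ p) ≡ᵇ g ]· f (proj₁ p) * h (proj₂ p))

cutAt-suc : ∀ g f h x β → cutAt (suc g) f h (x ∷ β) ≡
            ∑ (splits β) (λ p → [ x ℕ.+ size (proj₁ p) ≡ᵇ suc g ]· f (x ∷ proj₁ p) * h (proj₂ p))
cutAt-suc g f h x β = trans (ℚP.+-identityˡ _) (∑-map _ (splits β) _)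

cutAt-0 : ∀ f h {β} → Positive β → cutAt 0 f h β ≡ f [] * h β
cutAt-0 f h [] = ℚP.+-identityʳ _
cutAt-0 f h {suc x ∷ β} (_ ∷ _) =
  trans (cong (f [] * h (suc x ∷ β) +_) (trans (∑-map _ (splits β) _) (∑-zero (splits β) (λ _ → refl))))
        (ℚP.+-identityʳ _)

cutAt-inc : ∀ g f h {m β} → IsComp (suc m) β →
            cutAt (suc (suc g)) f h (inc β) ≡ cutAt (suc g) (f ∘ inc) h β
cutAt-inc g f h {β = x ∷ β} _ = trans (cutAt-suc (suc g) f h (suc x) β) (sym (cutAt-suc g (f ∘ inc) h x β))

cutAt-1-inc : ∀ f h {m β} → IsComp (suc m) β → cutAt 1 f h (inc β) ≡ 0ℚ
cutAt-1-inc f h {β = x ∷ β} i with IsComp-positive i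
... | z<s ∷ _ = trans (cutAt-suc 0 f h (suc x) β) (∑-zero (splits β) (λ _ → refl))

⟨↗⟩-0 : ∀ a b → ⟨ a ↗ b ⟩ 0ℚ ≡ 0ℚ
⟨↗⟩-0 a b with b <ᵇ a
... | true  = refl
... | false = refl

⟨↗⟩-* : ∀ a b q r → ⟨ a ↗ b ⟩ (q * r) ≡ (⟨ a ↗ b ⟩ q) * r
⟨↗⟩-* a b q r with b <ᵇ a
... | true  = sym (ℚP.*-zeroˡ r)
... | false = refl

-- The coproduct of F_{D(w)}, in the degree with g on the left, is F of the first g letters tensor F
-- of the others. Only those β contribute that can be cut after g, and for these the order of the
-- two letters at that place is irrelevant. The induction moves the first part of β into f, as
-- `f ∘ (1 ∷_)` or `f ∘ inc`, and so runs over all f.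
∑-E-cutAt : ∀ w g f h → g ℕ.≤ length w →
            ∑ (E w) (cutAt g f h) ≡ ∑ (E (take g w)) f * ∑ (E (drop g w)) h
∑-E-cutAt w zero f h _ = begin
  ∑ (E w) (cutAt 0 f h)          ≡⟨ ∑-cong∈ (E w) (λ β∈ → cutAt-0 f h (IsComp-positive (E-IsComp w β∈))) ⟩
  ∑ (E w) (λ β → f [] * h β)     ≡⟨ *-∑ (f []) (E w) h ⟨
  f [] * ∑ (E w) h               ≡⟨ cong (_* ∑ (E w) h) (ℚP.+-identityʳ (f [])) ⟨
  ∑ (E []) f * ∑ (E w) h         ∎
  where open ≡-Reasoning
∑-E-cutAt (a ∷ []) (suc zero) f h _ =
  trans (ℚP.+-identityʳ _) (trans (cutAt-suc 0 f h 1 []) (trans (ℚP.+-identityʳ _)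
    (sym (cong₂ _*_ (ℚP.+-identityʳ (f (1 ∷ []))) (ℚP.+-identityʳ (h []))))))
∑-E-cutAt (a ∷ []) (suc (suc g)) f h (s≤s ())
∑-E-cutAt (a ∷ b ∷ w) (suc zero) f h _ = begin
  ∑ (E (a ∷ b ∷ w)) (cutAt 1 f h)
    ≡⟨ ∑-E-∷ a b w (cutAt 1 f h) ⟩
  ∑ (E (b ∷ w)) (λ β → cutAt 1 f h (1 ∷ β)) + ⟨ a ↗ b ⟩ ∑ (E (b ∷ w)) (λ β → cutAt 1 f h (inc β))
    ≡⟨ cong₂ (λ p q → p + ⟨ a ↗ b ⟩ q)
         (∑-cong (E (b ∷ w)) (λ β → trans (cutAt-suc 0 f h 1 β) refl))
         (∑-zero (E (b ∷ w)) (λ β∈ → cutAt-1-inc f h (E-IsComp (b ∷ w) β∈))) ⟩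
  ∑ (E (b ∷ w)) (cutAt 0 (f ∘ (1 ∷_)) h) + ⟨ a ↗ b ⟩ 0ℚ
    ≡⟨ cong₂ _+_ (∑-E-cutAt (b ∷ w) zero (f ∘ (1 ∷_)) h z≤n) (⟨↗⟩-0 a b) ⟩
  (f (1 ∷ []) + 0ℚ) * ∑ (E (b ∷ w)) h + 0ℚ
    ≡⟨ ℚP.+-identityʳ _ ⟩
  (f (1 ∷ []) + 0ℚ) * ∑ (E (b ∷ w)) h ∎
  where open ≡-Reasoning
∑-E-cutAt (a ∷ b ∷ w) (suc (suc g)) f h (s≤s g≤) = begin
  ∑ (E (a ∷ b ∷ w)) (cutAt (suc (suc g)) f h)
    ≡⟨ ∑-E-∷ a b w (cutAt (suc (suc g)) f h) ⟩
  ∑ (E (b ∷ w)) (λ β → cutAt (suc (suc g)) f h (1 ∷ β)) + ⟨ a ↗ b ⟩ ∑ (E (b ∷ w)) (λ β → cutAt (suc (suc g)) f h (inc β))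
    ≡⟨ cong₂ (λ p q → p + ⟨ a ↗ b ⟩ q)
         (∑-cong (E (b ∷ w)) (λ β → cutAt-suc (suc g) f h 1 β))
         (∑-cong∈ (E (b ∷ w)) (λ β∈ → cutAt-inc g f h (E-IsComp (b ∷ w) β∈))) ⟩
  ∑ (E (b ∷ w)) (cutAt (suc g) (f ∘ (1 ∷_)) h) + ⟨ a ↗ b ⟩ ∑ (E (b ∷ w)) (cutAt (suc g) (f ∘ inc) h)
    ≡⟨ cong₂ (λ p q → p + ⟨ a ↗ b ⟩ q)
         (∑-E-cutAt (b ∷ w) (suc g) (f ∘ (1 ∷_)) h g≤)
         (∑-E-cutAt (b ∷ w) (suc g) (f ∘ inc) h g≤) ⟩
  ∑ (E w₁) (f ∘ (1 ∷_)) * H + ⟨ a ↗ b ⟩ (∑ (E w₁) (f ∘ inc) * H)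
    ≡⟨ cong (∑ (E w₁) (f ∘ (1 ∷_)) * H +_) (⟨↗⟩-* a b _ H) ⟩
  ∑ (E w₁) (f ∘ (1 ∷_)) * H + (⟨ a ↗ b ⟩ ∑ (E w₁) (f ∘ inc)) * H
    ≡⟨ ℚP.*-distribʳ-+ H (∑ (E w₁) (f ∘ (1 ∷_))) (⟨ a ↗ b ⟩ ∑ (E w₁) (f ∘ inc)) ⟨
  (∑ (E w₁) (f ∘ (1 ∷_)) + ⟨ a ↗ b ⟩ ∑ (E w₁) (f ∘ inc)) * H
    ≡⟨ cong (_* H) (∑-E-∷ a b (take g w) f) ⟨
  ∑ (E (a ∷ w₁)) f * H ∎
  where
  open ≡-Reasoning
  w₁ : List ℕ
  w₁ = b ∷ take g w
  H : ℚ
  H = ∑ (E (drop g w)) h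

-- Product of fundamental functions

sh : List ℕ → List ℕ → List (List ℕ)
sh []      v       = v ∷ []
sh (a ∷ u) []      = (a ∷ u) ∷ []
sh (a ∷ u) (b ∷ v) = map (a ∷_) (sh u (b ∷ v)) ++ map (b ∷_) (sh (a ∷ u) v)

sh-[] : ∀ u → sh u [] ≡ u ∷ []
sh-[] []      = refl
sh-[] (a ∷ u) = refl

qsh-[] : ∀ α → qsh α [] ≡ α ∷ []
qsh-[] []      = refl
qsh-[] (a ∷ α) = refl

-- The ways to write w = p ++ w′ with z ∷ p weakly increasing, recorded as (length p , w′).
pre : ℕ → List ℕ → List (ℕ × List ℕ)
pre z []      = (0 , []) ∷ []
pre z (a ∷ w) = (0 , a ∷ w) ∷ (if a <ᵇ z then [] else map (λ p → suc (proj₁ p) , proj₂ p) (pre a w))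

∑pre : ℕ → List ℕ → (ℕ → List ℕ → ℚ) → ℚ
∑pre z w h = ∑ (pre z w) (λ p → h (proj₁ p) (proj₂ p))

∑pre-∷ : ∀ z a w h → ∑pre z (a ∷ w) h ≡ h 0 (a ∷ w) + ⟨ z ↗ a ⟩ ∑pre a w (λ k → h (suc k))
∑pre-∷ z a w h with a <ᵇ z
... | true  = refl
... | false = cong (h 0 (a ∷ w) +_) (∑-map _ (pre a w) _)

pre-suffix : ∀ {z w k w′} → (k , w′) ∈ pre z w → ∃ λ p → p ++ w′ ≡ w
pre-suffix {w = []}    (here refl) = [] , refl
pre-suffix {w = a ∷ w} (here refl) = [] , refl
pre-suffix {z} {w = a ∷ w} (there k∈) with a <ᵇ z
... | false with _ , l∈ , refl ← ∈-map⁻ _ k∈ with p , e ← pre-suffix l∈ = a ∷ p , cong (a ∷_) e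

-- Groups the compositions by first part. A first part k + 1 omits the first k cuts, which is
-- allowed just when a and the next k letters increase weakly. The cut after them is always allowed,
-- and the rest is any element of `E w′`.
∑-E-pre : ∀ a w ψ → ∑ (E (a ∷ w)) ψ ≡ ∑pre a w (λ k w′ → ∑ (E w′) (λ β → ψ (suc k ∷ β)))
∑-E-pre a []      ψ = sym (ℚP.+-identityʳ _)
∑-E-pre a (b ∷ w) ψ = begin
  ∑ (E (a ∷ b ∷ w)) ψ
    ≡⟨ ∑-E-∷ a b w ψ ⟩
  ∑ (E (b ∷ w)) (ψ ∘ (1 ∷_)) + ⟨ a ↗ b ⟩ ∑ (E (b ∷ w)) (ψ ∘ inc)
    ≡⟨ cong (λ q → ∑ (E (b ∷ w)) (ψ ∘ (1 ∷_)) + ⟨ a ↗ b ⟩ q) (∑-E-pre b w (ψ ∘ inc)) ⟩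
  ∑ (E (b ∷ w)) (ψ ∘ (1 ∷_)) + ⟨ a ↗ b ⟩ ∑pre b w (λ k w′ → ∑ (E w′) (λ β → ψ (suc (suc k) ∷ β)))
    ≡⟨ ∑pre-∷ a b w (λ k w′ → ∑ (E w′) (λ β → ψ (suc k ∷ β))) ⟨
  ∑pre a (b ∷ w) (λ k w′ → ∑ (E w′) (λ β → ψ (suc k ∷ β))) ∎
  where open ≡-Reasoning

Disj : List ℕ → List ℕ → Set
Disj u v = All (λ a → All (a ≢_) v) u

Disj-tailʳ : ∀ {u b v} → Disj u (b ∷ v) → Disj u v
Disj-tailʳ = All.map All.tail

∑-sh-∷ : ∀ a u b v f → ∑ (sh (a ∷ u) (b ∷ v)) f ≡
         ∑ (sh u (b ∷ v)) (f ∘ (a ∷_)) + ∑ (sh (a ∷ u) v) (f ∘ (b ∷_))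
∑-sh-∷ a u b v f = trans (∑-++ (map (a ∷_) (sh u (b ∷ v))) _ f)
  (cong₂ _+_ (∑-map _ (sh u (b ∷ v)) f) (∑-map _ (sh (a ∷ u) v) f))

<ᵇ-true : ∀ {a b} → a ℕ.< b → (a <ᵇ b) ≡ true
<ᵇ-true a<b = Equivalence.to T-≡ (ℕP.<⇒<ᵇ a<b)

<ᵇ-false : ∀ {a b} → b ℕ.≤ a → (a <ᵇ b) ≡ false
<ᵇ-false {a} b≤a = ¬-not (λ e → ℕP.<⇒≱ (ℕP.<ᵇ⇒< a _ (Equivalence.from T-≡ e)) b≤a)

false⇒≥ : ∀ {a b} → (a <ᵇ b) ≡ false → b ℕ.≤ a
false⇒≥ e = ℕP.≮⇒≥ (λ a<b → contradiction (trans (sym (<ᵇ-true a<b)) e) λ ())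

⟨↗⟩-∑ : ∀ {A : Set} z a (xs : List A) f → ∑ xs (λ x → ⟨ z ↗ a ⟩ f x) ≡ ⟨ z ↗ a ⟩ ∑ xs f
⟨↗⟩-∑ z a xs f with a <ᵇ z
... | true  = ∑-zero xs (λ _ → refl)
... | false = refl

-- The contribution of a prefix of length i in one word and j in the other: merged they form a
-- prefix of length i + j, and the remainders are still to be shuffled.
shuffleSum : (ℕ → List ℕ → ℚ) → ℕ → List ℕ → ℕ → List ℕ → ℚ
shuffleSum h i u′ j v′ = ∑ (sh u′ v′) (h (i ℕ.+ j))

-- An increasing prefix of a shuffle consists of an increasing prefix of u and one of v, followed by
-- a shuffle of the remainders. Conversely two increasing prefixes merge into an increasing one in
-- exactly one way, because no letter of u equals a letter of v.
∑pre-sh : ∀ u v → Disj u v → ∀ z h →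
          ∑ (sh u v) (λ w → ∑pre z w h) ≡
          ∑pre z u (λ i u′ → ∑pre z v (λ j v′ → shuffleSum h i u′ j v′))
∑pre-sh [] v _ z h = cong (_+ 0ℚ) (∑-cong (pre z v) (λ p → sym (ℚP.+-identityʳ _)))
∑pre-sh u@(_ ∷ _) [] _ z h = trans (ℚP.+-identityʳ _) (∑-cong (pre z u) (λ { (i , u′) → sym (begin
  ∑ (sh u′ []) (h (i ℕ.+ 0)) + 0ℚ ≡⟨ ℚP.+-identityʳ _ ⟩
  ∑ (sh u′ []) (h (i ℕ.+ 0))      ≡⟨ cong₂ (λ L k → ∑ L (h k)) (sh-[] u′) (ℕP.+-identityʳ i) ⟩
  h i u′ + 0ℚ                     ≡⟨ ℚP.+-identityʳ _ ⟩
  h i u′                          ∎) }))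
  where open ≡-Reasoning
∑pre-sh (a ∷ u) (b ∷ v) ((a≢b ∷ a∉v) ∷ d) z h =
  step (∑pre-sh u (b ∷ v) d a h⁺) (∑pre-sh (a ∷ u) v (a∉v ∷ Disj-tailʳ d) b h⁺)
  where
  open ≡-Reasoning
  h⁺ : ℕ → List ℕ → ℚ
  h⁺ k = h (suc k)
  G : ℕ → List ℕ → ℕ → List ℕ → ℚ
  G = shuffleSum h
  -- The nonempty prefixes that begin with a and with b respectively; this letter is the lower bound
  -- for what follows.
  X Y : ℚ
  X = ∑pre a u (λ i u′ → ∑pre a (b ∷ v) (G (suc i) u′))
  Y = ∑pre b (a ∷ u) (λ i u′ → ∑pre b v (G (suc i) u′))

  -- The increasing prefix begins with the smaller of the two first letters that it uses.
  choose : ⟨ z ↗ a ⟩ X + ⟨ z ↗ b ⟩ Y ≡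
           ⟨ z ↗ a ⟩ ∑pre a u (λ i u′ → ∑pre z (b ∷ v) (G (suc i) u′)) + ⟨ z ↗ b ⟩ ∑pre b v (λ j → G 0 (a ∷ u) (suc j))
  choose with ℕP.<-cmp a b
  ... | tri≈ _ a≡b _ = contradiction a≡b a≢b
  ... | tri< a<b _ _ = cong₂ _+_ left (cong (λ q → ⟨ z ↗ b ⟩ q) right)
    where
    left : ⟨ z ↗ a ⟩ X ≡ ⟨ z ↗ a ⟩ ∑pre a u (λ i u′ → ∑pre z (b ∷ v) (G (suc i) u′))
    left with a <ᵇ z in eq
    ... | true  = refl
    ... | false = ∑-cong (pre a u) (λ { (i , u′) →
      trans (∑pre-∷ a b v (G (suc i) u′)) (trans (cong (λ t → G (suc i) u′ 0 (b ∷ v) + (if t then 0ℚ else ∑pre b v (λ k → G (suc i) u′ (suc k))))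
        (trans (<ᵇ-false {b} {a} (ℕP.<⇒≤ a<b)) (sym (<ᵇ-false {b} {z} (ℕP.≤-trans (false⇒≥ {a} eq) (ℕP.<⇒≤ a<b))))))
      (sym (∑pre-∷ z b v (G (suc i) u′)))) })
    right : Y ≡ ∑pre b v (λ j → G 0 (a ∷ u) (suc j))
    right = trans (∑pre-∷ b a u (λ i u′ → ∑pre b v (G (suc i) u′)))
      (trans (cong (λ t → ∑pre b v (G 1 (a ∷ u)) + (if t then 0ℚ else ∑pre a u (λ i u′ → ∑pre b v (G (suc (suc i)) u′)))) (<ᵇ-true a<b))
             (ℚP.+-identityʳ _))
  -- The right-hand side selects the prefix of u first, so the prefixes using both words stand in
  -- its a-summand. For b < a they arise in Y, as Y₁, and have to be moved over. This is possible
  -- because z ≤ b implies z ≤ a.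
  ... | tri> _ _ b<a = begin
    ⟨ z ↗ a ⟩ X + ⟨ z ↗ b ⟩ Y
      ≡⟨ cong₂ (λ p q → ⟨ z ↗ a ⟩ p + ⟨ z ↗ b ⟩ q) X≡ Y≡ ⟩
    ⟨ z ↗ a ⟩ X₀ + ⟨ z ↗ b ⟩ (Y₀ + Y₁)
      ≡⟨ regroup ⟩
    ⟨ z ↗ a ⟩ (X₀ + ⟨ z ↗ b ⟩ Y₁) + ⟨ z ↗ b ⟩ Y₀
      ≡⟨ cong (λ q → ⟨ z ↗ a ⟩ q + ⟨ z ↗ b ⟩ Y₀) both ⟨
    ⟨ z ↗ a ⟩ ∑pre a u (λ i u′ → ∑pre z (b ∷ v) (G (suc i) u′)) + ⟨ z ↗ b ⟩ Y₀ ∎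
    where
    X₀ Y₀ Y₁ : ℚ
    X₀ = ∑pre a u (λ i u′ → G (suc i) u′ 0 (b ∷ v))
    Y₀ = ∑pre b v (λ j → G 0 (a ∷ u) (suc j))
    Y₁ = ∑pre a u (λ i u′ → ∑pre b v (λ j → G (suc i) u′ (suc j)))
    X≡ : X ≡ X₀
    X≡ = ∑-cong (pre a u) (λ { (i , u′) → trans (∑pre-∷ a b v (G (suc i) u′))
      (trans (cong (λ t → G (suc i) u′ 0 (b ∷ v) + (if t then 0ℚ else ∑pre b v (λ k → G (suc i) u′ (suc k)))) (<ᵇ-true b<a))
             (ℚP.+-identityʳ _)) })
    Y≡ : Y ≡ Y₀ + Y₁
    Y≡ = trans (∑pre-∷ b a u (λ i u′ → ∑pre b v (G (suc i) u′)))
      (trans (cong (λ t → Y₀ + (if t then 0ℚ else ∑pre a u (λ i u′ → ∑pre b v (G (suc (suc i)) u′)))) (<ᵇ-false (ℕP.<⇒≤ b<a)))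
        (cong (Y₀ +_) (∑-cong (pre a u) (λ { (i , u′) → ∑-cong (pre b v) (λ { (j , v′) →
          cong (λ k → ∑ (sh u′ v′) (h (suc k))) (sym (ℕP.+-suc i j)) }) }))))
    both : ∑pre a u (λ i u′ → ∑pre z (b ∷ v) (G (suc i) u′)) ≡ X₀ + ⟨ z ↗ b ⟩ Y₁
    both = begin
      ∑pre a u (λ i u′ → ∑pre z (b ∷ v) (G (suc i) u′))
        ≡⟨ ∑-cong (pre a u) (λ { (i , u′) → ∑pre-∷ z b v (G (suc i) u′) }) ⟩
      ∑pre a u (λ i u′ → G (suc i) u′ 0 (b ∷ v) + ⟨ z ↗ b ⟩ ∑pre b v (λ j → G (suc i) u′ (suc j)))
        ≡⟨ ∑-+ (pre a u) _ _ ⟩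
      X₀ + ∑pre a u (λ i u′ → ⟨ z ↗ b ⟩ ∑pre b v (λ j → G (suc i) u′ (suc j)))
        ≡⟨ cong (X₀ +_) (⟨↗⟩-∑ z b (pre a u) _) ⟩
      X₀ + ⟨ z ↗ b ⟩ Y₁ ∎
    regroup : ⟨ z ↗ a ⟩ X₀ + ⟨ z ↗ b ⟩ (Y₀ + Y₁) ≡ ⟨ z ↗ a ⟩ (X₀ + ⟨ z ↗ b ⟩ Y₁) + ⟨ z ↗ b ⟩ Y₀
    regroup with b <ᵇ z in eq
    ... | true  = cong (λ q → ⟨ z ↗ a ⟩ q + 0ℚ) (sym (ℚP.+-identityʳ X₀))
    ... | false rewrite <ᵇ-false {a} {z} (ℕP.≤-trans (false⇒≥ {b} eq) (ℕP.<⇒≤ b<a)) =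
      trans (cong (X₀ +_) (ℚP.+-comm Y₀ Y₁)) (sym (ℚP.+-assoc X₀ Y₁ Y₀))

  step : ∑ (sh u (b ∷ v)) (λ w → ∑pre a w h⁺) ≡ X → ∑ (sh (a ∷ u) v) (λ w → ∑pre b w h⁺) ≡ Y →
         ∑ (sh (a ∷ u) (b ∷ v)) (λ w → ∑pre z w h) ≡ ∑pre z (a ∷ u) (λ i u′ → ∑pre z (b ∷ v) (G i u′))
  step ih₁ ih₂ = begin
    ∑ (sh (a ∷ u) (b ∷ v)) (λ w → ∑pre z w h)
      ≡⟨ ∑-sh-∷ a u b v (λ w → ∑pre z w h) ⟩
    ∑ (sh u (b ∷ v)) (λ w → ∑pre z (a ∷ w) h) + ∑ (sh (a ∷ u) v) (λ w → ∑pre z (b ∷ w) h)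
      ≡⟨ cong₂ _+_ (expand a (sh u (b ∷ v)) ih₁) (expand b (sh (a ∷ u) v) ih₂) ⟩
    (∑ (sh u (b ∷ v)) (h 0 ∘ (a ∷_)) + ⟨ z ↗ a ⟩ X) + (∑ (sh (a ∷ u) v) (h 0 ∘ (b ∷_)) + ⟨ z ↗ b ⟩ Y)
      ≡⟨ +-interchange (∑ (sh u (b ∷ v)) (h 0 ∘ (a ∷_))) (⟨ z ↗ a ⟩ X) (∑ (sh (a ∷ u) v) (h 0 ∘ (b ∷_))) (⟨ z ↗ b ⟩ Y) ⟩
    (∑ (sh u (b ∷ v)) (h 0 ∘ (a ∷_)) + ∑ (sh (a ∷ u) v) (h 0 ∘ (b ∷_))) + (⟨ z ↗ a ⟩ X + ⟨ z ↗ b ⟩ Y)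
      ≡⟨ cong₂ _+_ (sym (∑-sh-∷ a u b v (h 0))) choose ⟩
    G 0 (a ∷ u) 0 (b ∷ v) + (R + ⟨ z ↗ b ⟩ ∑pre b v (λ j → G 0 (a ∷ u) (suc j)))
      ≡⟨ cong (G 0 (a ∷ u) 0 (b ∷ v) +_) (ℚP.+-comm R _) ⟩
    G 0 (a ∷ u) 0 (b ∷ v) + (⟨ z ↗ b ⟩ ∑pre b v (λ j → G 0 (a ∷ u) (suc j)) + R)
      ≡⟨ ℚP.+-assoc (G 0 (a ∷ u) 0 (b ∷ v)) _ R ⟨
    G 0 (a ∷ u) 0 (b ∷ v) + ⟨ z ↗ b ⟩ ∑pre b v (λ j → G 0 (a ∷ u) (suc j)) + R
      ≡⟨ cong (_+ R) (∑pre-∷ z b v (G 0 (a ∷ u))) ⟨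
    ∑pre z (b ∷ v) (G 0 (a ∷ u)) + R
      ≡⟨ ∑pre-∷ z a u (λ i u′ → ∑pre z (b ∷ v) (G i u′)) ⟨
    ∑pre z (a ∷ u) (λ i u′ → ∑pre z (b ∷ v) (G i u′)) ∎
    where
    R : ℚ
    R = ⟨ z ↗ a ⟩ ∑pre a u (λ i u′ → ∑pre z (b ∷ v) (G (suc i) u′))
    expand : ∀ c L {q} → ∑ L (λ w → ∑pre c w h⁺) ≡ q →
             ∑ L (λ w → ∑pre z (c ∷ w) h) ≡ ∑ L (h 0 ∘ (c ∷_)) + ⟨ z ↗ c ⟩ q
    expand c L ih = trans (∑-cong L (λ w → ∑pre-∷ z c w h)) (trans (∑-+ L _ _)
      (cong (∑ L (h 0 ∘ (c ∷_)) +_) (trans (⟨↗⟩-∑ z c L _) (cong (λ q → ⟨ z ↗ c ⟩ q) ih))))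

∑-qsh-∷ : ∀ x α y β (ψ : Comp → ℚ) → ∑ (qsh (x ∷ α) (y ∷ β)) ψ ≡
  ∑ (qsh α (y ∷ β)) (ψ ∘ (x ∷_)) + (∑ (qsh (x ∷ α) β) (ψ ∘ (y ∷_)) + ∑ (qsh α β) (ψ ∘ ((x ℕ.+ y) ∷_)))
∑-qsh-∷ x α y β ψ = trans (∑-++ (map (x ∷_) (qsh α (y ∷ β))) _ ψ)
  (cong₂ _+_ (∑-map _ (qsh α (y ∷ β)) ψ) (trans (∑-++ (map (y ∷_) (qsh (x ∷ α) β)) _ ψ)
    (cong₂ _+_ (∑-map _ (qsh (x ∷ α) β) ψ) (∑-map _ (qsh α β) ψ))))

-- `E` of a nonempty word contains no empty composition, so values there do not matter.
∑-E-cong : ∀ a w {f g : Comp → ℚ} → (∀ x β → f (x ∷ β) ≡ g (x ∷ β)) → ∑ (E (a ∷ w)) f ≡ ∑ (E (a ∷ w)) g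
∑-E-cong a w {f} {g} e = trans (∑-E-pre a w f)
  (trans (∑-cong (pre a w) (λ { (k , w′) → ∑-cong (E w′) (λ β → e (suc k) β) })) (sym (∑-E-pre a w g)))

Disj-suffix : ∀ p {u} q {v} → Disj (p ++ u) (q ++ v) → Disj u v
Disj-suffix p q d = All.map (AllP.++⁻ʳ q) (AllP.++⁻ʳ p d)

length-suffix : ∀ (p : List ℕ) {u} → length u ℕ.≤ length (p ++ u)
length-suffix []      = ℕP.≤-refl
length-suffix (_ ∷ p) = ℕP.m≤n⇒m≤1+n (length-suffix p)

-- The product rule for F_{D(u)} and F_{D(v)}. Both sides are sorted by the first part of the
-- resulting composition. On the shuffle side that part is an increasing prefix, taken from u alone,
-- from v alone or from both by `∑pre-sh`; these cases match the three terms of the quasi-shuffle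
-- recursion. What remains is a pair of shorter suffixes, hence the induction on the total length.
E-sh : ∀ u v → Disj u v → ∀ ψ →
       ∑ (sh u v) (λ w → ∑ (E w) ψ) ≡ ∑ (E u) (λ α → ∑ (E v) (λ β → ∑ (qsh α β) ψ))
E-sh u v d ψ = bounded (length u ℕ.+ length v) u v ℕP.≤-refl d ψ
  where
  open ≡-Reasoning
  ProductRule : List ℕ → List ℕ → Set
  ProductRule u v = Disj u v → ∀ ψ →
    ∑ (sh u v) (λ w → ∑ (E w) ψ) ≡ ∑ (E u) (λ α → ∑ (E v) (λ β → ∑ (qsh α β) ψ))

  module Step (a : ℕ) (u : List ℕ) (b : ℕ) (v : List ℕ) (d : Disj (a ∷ u) (b ∷ v))
    (ih : ∀ p {u′} q {v′} → p ++ u′ ≡ a ∷ u → q ++ v′ ≡ b ∷ v →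
          length u′ ℕ.+ length v′ ℕ.≤ length u ℕ.+ suc (length v) → ProductRule u′ v′)
    (ψ : Comp → ℚ) where

    -- A first part is positive, so the empty prefix has to count 0. The bound 0 used in `E-h`
    -- admits every letter.
    h : ℕ → List ℕ → ℚ
    h zero    w = 0ℚ
    h (suc k) w = ∑ (E w) (λ β → ψ (suc k ∷ β))

    E-h : ∀ c w → ∑ (E (c ∷ w)) ψ ≡ ∑pre 0 (c ∷ w) h
    E-h c w = trans (∑-E-pre c w ψ) (sym (trans (∑pre-∷ 0 c w h) (ℚP.+-identityˡ _)))

    -- The three terms of the quasi-shuffle recursion, extended by 0 to empty compositions, which do
    -- not occur for nonempty words.
    X₁ X₂ X₃ : Comp → Comp → ℚ
    X₁ []      β       = 0ℚ
    X₁ (x ∷ α) β       = ∑ (qsh α β) (ψ ∘ (x ∷_))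
    X₂ α       []      = 0ℚ
    X₂ α       (y ∷ β) = ∑ (qsh α β) (ψ ∘ (y ∷_))
    X₃ []      β       = 0ℚ
    X₃ (x ∷ α) []      = 0ℚ
    X₃ (x ∷ α) (y ∷ β) = ∑ (qsh α β) (ψ ∘ ((x ℕ.+ y) ∷_))

    ∑∑ : (Comp → Comp → ℚ) → ℚ
    ∑∑ f = ∑ (E (a ∷ u)) (λ α → ∑ (E (b ∷ v)) (f α))

    qsh-X : ∑∑ (λ α β → ∑ (qsh α β) ψ) ≡ ∑∑ X₁ + (∑∑ X₂ + ∑∑ X₃)
    qsh-X = begin
      ∑∑ (λ α β → ∑ (qsh α β) ψ)
        ≡⟨ ∑-E-cong a u (λ x α → ∑-E-cong b v (λ y β → ∑-qsh-∷ x α y β ψ)) ⟩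
      ∑∑ (λ α β → X₁ α β + (X₂ α β + X₃ α β))
        ≡⟨ ∑∑-+ X₁ (λ α β → X₂ α β + X₃ α β) ⟩
      ∑∑ X₁ + ∑∑ (λ α β → X₂ α β + X₃ α β)
        ≡⟨ cong (∑∑ X₁ +_) (∑∑-+ X₂ X₃) ⟩
      ∑∑ X₁ + (∑∑ X₂ + ∑∑ X₃) ∎
      where
      ∑∑-+ : ∀ f g → ∑∑ (λ α β → f α β + g α β) ≡ ∑∑ f + ∑∑ g
      ∑∑-+ f g = trans (∑-cong (E (a ∷ u)) (λ α → ∑-+ (E (b ∷ v)) (f α) (g α))) (∑-+ (E (a ∷ u)) _ _)

    bound₁ : ∀ p {u′} → p ++ u′ ≡ u → length u′ ℕ.+ suc (length v) ℕ.≤ length u ℕ.+ suc (length v)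
    bound₁ p refl = ℕP.+-monoˡ-≤ (suc (length v)) (length-suffix p)

    bound₂ : ∀ q {v′} → q ++ v′ ≡ v → suc (length u) ℕ.+ length v′ ℕ.≤ length u ℕ.+ suc (length v)
    bound₂ q {v′} refl = subst (suc (length u) ℕ.+ length v′ ℕ.≤_) (sym (ℕP.+-suc (length u) (length v)))
                          (ℕP.+-monoʳ-≤ (suc (length u)) (length-suffix q))

    bound₃ : ∀ p {u′} q {v′} → p ++ u′ ≡ u → q ++ v′ ≡ v →
             length u′ ℕ.+ length v′ ℕ.≤ length u ℕ.+ suc (length v)
    bound₃ p q refl refl = ℕP.+-mono-≤ (length-suffix p) (ℕP.m≤n⇒m≤1+n (length-suffix q))

    S₁ : ∑pre a u (λ i u′ → ∑ (sh u′ (b ∷ v)) (h (suc i))) ≡ ∑∑ X₁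
    S₁ = trans (∑-cong∈ (pre a u) (λ { {i , u′} i∈ → rule i u′ (pre-suffix i∈) }))
               (sym (∑-E-pre a u (λ α → ∑ (E (b ∷ v)) (X₁ α))))
      where
      rule : ∀ i u′ → (∃ λ p → p ++ u′ ≡ u) →
             ∑ (sh u′ (b ∷ v)) (h (suc i)) ≡ ∑ (E u′) (λ α → ∑ (E (b ∷ v)) (X₁ (suc i ∷ α)))
      rule i u′ (p , refl) = ih (a ∷ p) [] refl refl (bound₁ p refl) (Disj-suffix (a ∷ p) [] d) (λ β → ψ (suc i ∷ β))

    S₂ : ∑pre b v (λ j v′ → ∑ (sh (a ∷ u) v′) (h (suc j))) ≡ ∑∑ X₂
    S₂ = trans (∑-cong∈ (pre b v) (λ { {j , v′} j∈ → rule j v′ (pre-suffix j∈) }))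
        (trans (sym (∑-E-pre b v (λ β → ∑ (E (a ∷ u)) (λ α → X₂ α β))))
               (∑-swap (E (b ∷ v)) (E (a ∷ u)) (λ β α → X₂ α β)))
      where
      rule : ∀ j v′ → (∃ λ q → q ++ v′ ≡ v) →
             ∑ (sh (a ∷ u) v′) (h (suc j)) ≡ ∑ (E v′) (λ β → ∑ (E (a ∷ u)) (λ α → X₂ α (suc j ∷ β)))
      rule j v′ (q , refl) =
        trans (ih [] (b ∷ q) refl refl (bound₂ q refl) (Disj-suffix [] (b ∷ q) d) (λ β → ψ (suc j ∷ β)))
              (∑-swap (E (a ∷ u)) (E v′) _)

    S₃ : ∑pre a u (λ i u′ → ∑pre b v (λ j v′ → ∑ (sh u′ v′) (h (suc i ℕ.+ suc j)))) ≡ ∑∑ X₃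
    S₃ = trans (∑-cong∈ (pre a u) (λ { {i , u′} i∈ → rule i u′ (pre-suffix i∈) }))
               (sym (∑-E-pre a u (λ α → ∑ (E (b ∷ v)) (X₃ α))))
      where
      rule : ∀ i u′ → (∃ λ p → p ++ u′ ≡ u) →
             ∑pre b v (λ j v′ → ∑ (sh u′ v′) (h (suc i ℕ.+ suc j)))
             ≡ ∑ (E u′) (λ α → ∑ (E (b ∷ v)) (X₃ (suc i ∷ α)))
      rule i u′ (p , p≡) = begin
        ∑pre b v (λ j v′ → ∑ (sh u′ v′) (h (suc i ℕ.+ suc j)))
          ≡⟨ ∑-cong∈ (pre b v) (λ { {j , v′} j∈ → let (q , q≡) = pre-suffix j∈ in
               ih (a ∷ p) (b ∷ q) (cong (a ∷_) p≡) (cong (b ∷_) q≡) (bound₃ p q p≡ q≡)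
                  (Disj-suffix (a ∷ p) (b ∷ q) (subst₂ Disj (sym (cong (a ∷_) p≡)) (sym (cong (b ∷_) q≡)) d))
                  (λ β → ψ (suc i ℕ.+ suc j ∷ β)) }) ⟩
        ∑pre b v (λ j v′ → ∑ (E u′) (λ α → ∑ (E v′) (λ β → X₃ (suc i ∷ α) (suc j ∷ β))))
          ≡⟨ ∑-swap (pre b v) (E u′) _ ⟩
        ∑ (E u′) (λ α → ∑pre b v (λ j v′ → ∑ (E v′) (λ β → X₃ (suc i ∷ α) (suc j ∷ β))))
          ≡⟨ ∑-cong (E u′) (λ α → ∑-E-pre b v (X₃ (suc i ∷ α))) ⟨
        ∑ (E u′) (λ α → ∑ (E (b ∷ v)) (X₃ (suc i ∷ α))) ∎

    result : ∑ (sh (a ∷ u) (b ∷ v)) (λ w → ∑ (E w) ψ) ≡ ∑∑ (λ α β → ∑ (qsh α β) ψ)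
    result = begin
      ∑ (sh (a ∷ u) (b ∷ v)) (λ w → ∑ (E w) ψ)
        ≡⟨ trans (∑-sh-∷ a u b v _) (trans (cong₂ _+_ (∑-cong (sh u (b ∷ v)) (E-h a)) (∑-cong (sh (a ∷ u) v) (E-h b))) (sym (∑-sh-∷ a u b v _))) ⟩
      ∑ (sh (a ∷ u) (b ∷ v)) (λ w → ∑pre 0 w h)
        ≡⟨ ∑pre-sh (a ∷ u) (b ∷ v) d 0 h ⟩
      ∑pre 0 (a ∷ u) (λ i u′ → ∑pre 0 (b ∷ v) (G i u′))
        ≡⟨ ∑pre-∷ 0 a u (λ i u′ → ∑pre 0 (b ∷ v) (G i u′)) ⟩
      ∑pre 0 (b ∷ v) (G 0 (a ∷ u)) + ∑pre a u (λ i u′ → ∑pre 0 (b ∷ v) (G (suc i) u′))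
        ≡⟨ cong₂ _+_ (trans (∑pre-∷ 0 b v (G 0 (a ∷ u))) (trans (cong (_+ V) (∑-zero (sh (a ∷ u) (b ∷ v)) (λ _ → refl))) (ℚP.+-identityˡ V)))
             (trans (∑-cong (pre a u) (λ { (i , u′) → ∑pre-∷ 0 b v (G (suc i) u′) })) (∑-+ (pre a u) _ _)) ⟩
      V + (∑pre a u (λ i u′ → G (suc i) u′ 0 (b ∷ v)) + W)
        ≡⟨ cong (λ q → V + (q + W)) (∑-cong (pre a u) (λ { (i , u′) → cong (λ k → ∑ (sh u′ (b ∷ v)) (h k)) (ℕP.+-identityʳ (suc i)) })) ⟩
      V + (∑pre a u (λ i u′ → ∑ (sh u′ (b ∷ v)) (h (suc i))) + W)
        ≡⟨ cong₂ _+_ S₂ (cong₂ _+_ S₁ S₃) ⟩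
      ∑∑ X₂ + (∑∑ X₁ + ∑∑ X₃)
        ≡⟨ +-leftComm (∑∑ X₂) (∑∑ X₁) (∑∑ X₃) ⟩
      ∑∑ X₁ + (∑∑ X₂ + ∑∑ X₃)
        ≡⟨ qsh-X ⟨
      ∑∑ (λ α β → ∑ (qsh α β) ψ) ∎
      where
      G : ℕ → List ℕ → ℕ → List ℕ → ℚ
      G = shuffleSum h
      V W : ℚ
      V = ∑pre b v (λ j v′ → ∑ (sh (a ∷ u) v′) (h (suc j)))
      W = ∑pre a u (λ i u′ → ∑pre b v (λ j v′ → ∑ (sh u′ v′) (h (suc i ℕ.+ suc j))))

  bounded : ∀ n u v → length u ℕ.+ length v ℕ.≤ n → ProductRule u v
  bounded n [] v _ d ψ = cong (_+ 0ℚ) (∑-cong (E v) (λ β → sym (ℚP.+-identityʳ _)))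
  bounded n u@(_ ∷ _) [] _ d ψ = trans (ℚP.+-identityʳ _) (∑-cong (E u) (λ α → sym (begin
    ∑ (qsh α []) ψ + 0ℚ ≡⟨ ℚP.+-identityʳ _ ⟩
    ∑ (qsh α []) ψ      ≡⟨ cong (λ L → ∑ L ψ) (qsh-[] α) ⟩
    ψ α + 0ℚ            ≡⟨ ℚP.+-identityʳ _ ⟩
    ψ α                 ∎)))
  bounded (suc n) (a ∷ u) (b ∷ v) (s≤s ≤n) d ψ =
    Step.result a u b v d (λ _ _ _ _ ≤m → bounded n _ _ (ℕP.≤-trans ≤m ≤n)) ψ

Unique-resp-↭ : ∀ {xs ys : List ℕ} → xs ↭ ys → Unique xs → Unique ys
Unique-resp-↭ p = PermS.Unique-resp-↭ (setoid ℕ) (↭⇒↭ₛ p)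

unique-⊆⊇⇒↭ : ∀ {A : Set} {xs ys : List A} → Unique xs → Unique ys →
              (∀ {x} → x ∈ xs → x ∈ ys) → (∀ {x} → x ∈ ys → x ∈ xs) → xs ↭ ys
unique-⊆⊇⇒↭ p q f g = ∼bag⇒↭ (unique∧set⇒bag p q (mk⇔ f g))

-- Shuffles

interleaving-[]ˡ : ∀ (w : List ℕ) → Interleaving [] w w
interleaving-[]ˡ []      = []
interleaving-[]ˡ (_ ∷ w) = consʳ (interleaving-[]ˡ w)

interleaving-[]ʳ : ∀ (w : List ℕ) → Interleaving w [] w
interleaving-[]ʳ []      = []
interleaving-[]ʳ (_ ∷ w) = consˡ (interleaving-[]ʳ w)

sh⇒interleaving : ∀ u v {w} → w ∈ sh u v → Interleaving u v w
sh⇒interleaving []      v       (here refl) = interleaving-[]ˡ v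
sh⇒interleaving (a ∷ u) []      (here refl) = interleaving-[]ʳ (a ∷ u)
sh⇒interleaving (a ∷ u) (b ∷ v) w∈ with ∈-++⁻ (map (a ∷_) (sh u (b ∷ v))) w∈
... | inj₁ p with _ , q , refl ← ∈-map⁻ (a ∷_) p = consˡ (sh⇒interleaving u (b ∷ v) q)
... | inj₂ p with _ , q , refl ← ∈-map⁻ (b ∷_) p = consʳ (sh⇒interleaving (a ∷ u) v q)

interleaving⇒sh : ∀ {u v w} → Interleaving u v w → w ∈ sh u v
interleaving⇒sh [] = here refl
interleaving⇒sh {a ∷ u} {[]} (consˡ i) with subst (_ ∈_) (sh-[] u) (interleaving⇒sh i)
... | here refl = here refl
interleaving⇒sh {a ∷ u} {b ∷ v} (consˡ i) = ∈-++⁺ˡ (∈-map⁺ (a ∷_) (interleaving⇒sh i))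
interleaving⇒sh {[]} {b ∷ v} (consʳ i) with interleaving⇒sh i
... | here refl = here refl
interleaving⇒sh {a ∷ u} {b ∷ v} (consʳ i) =
  ∈-++⁺ʳ (map (a ∷_) (sh u (b ∷ v))) (∈-map⁺ (b ∷_) (interleaving⇒sh i))

interleaving-All : ∀ {P : Pred ℕ 0ℓ} {u v w} → Interleaving u v w → All P w → All P u × All P v
interleaving-All []        []       = [] , []
interleaving-All (consˡ i) (p ∷ ps) with pu , pv ← interleaving-All i ps = p ∷ pu , pv
interleaving-All (consʳ i) (p ∷ ps) with pu , pv ← interleaving-All i ps = pu , p ∷ pv

interleaving-AllPairs : ∀ {R : Rel ℕ 0ℓ} {u v w} → Interleaving u v w → AllPairs R w → AllPairs R u × AllPairs R v
interleaving-AllPairs []        []       = [] , []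
interleaving-AllPairs (consˡ i) (r ∷ rs) with ru , rv ← interleaving-AllPairs i rs = proj₁ (interleaving-All i r) ∷ ru , rv
interleaving-AllPairs (consʳ i) (r ∷ rs) with ru , rv ← interleaving-AllPairs i rs = ru , proj₂ (interleaving-All i r) ∷ rv

module _ {P : Pred ℕ 0ℓ} (P? : Unary.Decidable P) where

  interleaving-filter : ∀ w → Interleaving (filter P? w) (filter (¬? ∘ P?) w) w
  interleaving-filter []      = []
  interleaving-filter (a ∷ w) with P? a
  ... | yes _ = consˡ (interleaving-filter w)
  ... | no _  = consʳ (interleaving-filter w)

  filter-interleavingʳ : ∀ {u v w} → Interleaving u v w → All (¬_ ∘ P) u → All P v → filter P? w ≡ v
  filter-interleavingʳ []                []        []       = refl
  filter-interleavingʳ {a ∷ _} (consˡ i) (¬p ∷ ns) ps       with P? a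
  ... | yes p = contradiction p ¬p
  ... | no _  = filter-interleavingʳ i ns ps
  filter-interleavingʳ {v = b ∷ _} (consʳ i) ns   (p ∷ ps) with P? b
  ... | yes _ = cong (b ∷_) (filter-interleavingʳ i ns ps)
  ... | no ¬p = contradiction p ¬p

Disj-∉ : ∀ {u v} → Disj u v → All (_∉ u) v
Disj-∉ {u} {v} d = All.tabulate (λ b∈v b∈u → All.lookup (All.lookup d b∈u) b∈v refl)

-- Deleting the letters of u from w leaves the other word.
sh-injective : ∀ u {v v′ w} → Disj u v → Disj u v′ → w ∈ sh u v → w ∈ sh u v′ → v ≡ v′
sh-injective u {v} {v′} d d′ w∈ w∈′ = trans (sym (eq d w∈)) (eq d′ w∈′)
  where
  eq : ∀ {v w} → Disj u v → w ∈ sh u v → filter (λ a → ¬? (a ∈? u)) w ≡ v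
  eq {v} d w∈ = filter-interleavingʳ (λ a → ¬? (a ∈? u)) (sh⇒interleaving u v w∈)
                  (All.tabulate (λ a∈ a∉ → a∉ a∈)) (Disj-∉ d)

sh-unique : ∀ u v → Disj u v → Unique (sh u v)
sh-unique []      v       d = [] ∷ []
sh-unique (a ∷ u) []      d = [] ∷ []
sh-unique (a ∷ u) (b ∷ v) ((a≢b ∷ a∉v) ∷ d) =
  Uniq.++⁺ (Uniq.map⁺ ∷-injectiveʳ (sh-unique u (b ∷ v) d))
           (Uniq.map⁺ ∷-injectiveʳ (sh-unique (a ∷ u) v (a∉v ∷ Disj-tailʳ d))) heads
  where
  heads : ∀ {w} → w ∈ map (a ∷_) (sh u (b ∷ v)) × w ∈ map (b ∷_) (sh (a ∷ u) v) → _
  heads (p , q) with ∈-map⁻ (a ∷_) p | ∈-map⁻ (b ∷_) q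
  ... | _ , _ , refl | _ , _ , e = a≢b (∷-injectiveˡ e)

∈-concatMap-sh⁻ : ∀ u {L w} → w ∈ concatMap (sh u) L → ∃ λ v → v ∈ L × w ∈ sh u v
∈-concatMap-sh⁻ u {L} w∈ = find (∈-concatMap⁻ (sh u) {xs = L} w∈)

∈-concatMap-sh⁺ : ∀ u {L v w} → v ∈ L → w ∈ sh u v → w ∈ concatMap (sh u) L
∈-concatMap-sh⁺ u {L} v∈ w∈ = ∈-concatMap⁺ (sh u) {xs = L} (lose v∈ w∈)

concatMap-sh-unique : ∀ u {L} → Unique L → All (Disj u) L → Unique (concatMap (sh u) L)
concatMap-sh-unique u {[]}    _        _        = []
concatMap-sh-unique u {v ∷ L} (v∉ ∷ U) (d ∷ ds) =
  Uniq.++⁺ (sh-unique u v d) (concatMap-sh-unique u U ds) disjoint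
  where
  disjoint : ∀ {w} → w ∈ sh u v × w ∈ concatMap (sh u) L → _
  disjoint (p , q) with v′ , v′∈ , q′ ← ∈-concatMap-sh⁻ u q =
    All.lookup v∉ v′∈ (sh-injective u d (All.lookup ds v′∈) p q′)

-- The shuffles of the consecutive blocks of w of lengths γ. Letters beyond `size γ` are lost, which
-- is why the sizes are required to agree below.
Sh : Comp → List ℕ → List (List ℕ)
Sh []      w = [] ∷ []
Sh (g ∷ γ) w = concatMap (sh (take g w)) (Sh γ (drop g w))

size-drop : ∀ g γ (w : List ℕ) → size (g ∷ γ) ≡ length w → size γ ≡ length (drop g w)
size-drop g γ w e = sym (trans (length-drop g w) (trans (cong (_∸ g) (sym e)) (ℕP.m+n∸m≡n g (size γ))))

Sh-↭ : ∀ γ w {u} → size γ ≡ length w → u ∈ Sh γ w → u ↭ w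
Sh-↭ []      []  _ (here refl) = ↭-refl
Sh-↭ (g ∷ γ) w {u} e u∈ with v , v∈ , u∈′ ← ∈-concatMap-sh⁻ (take g w) u∈ =
  ↭-trans (toPermutation (sh⇒interleaving (take g w) v u∈′))
    (↭-trans (PermP.++⁺ˡ (take g w) (Sh-↭ γ (drop g w) (size-drop g γ w e) v∈)) (↭-reflexive (take++drop≡id g w)))

Disj-++ : ∀ u {v} → Unique (u ++ v) → Disj u v
Disj-++ []      _        = []
Disj-++ (a ∷ u) (p ∷ ps) = AllP.++⁻ʳ u p ∷ Disj-++ u ps

Disj-take-drop : ∀ g {w} → Unique w → Disj (take g w) (drop g w)
Disj-take-drop g {w} U = Disj-++ (take g w) (subst Unique (sym (take++drop≡id g w)) U)

Disj-Sh : ∀ g γ w {v} → size (g ∷ γ) ≡ length w → Unique w → v ∈ Sh γ (drop g w) → Disj (take g w) v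
Disj-Sh g γ w e U v∈ = All.map (λ a∉ → PermP.All-resp-↭ (↭-sym (Sh-↭ γ (drop g w) (size-drop g γ w e) v∈)) a∉)
                               (Disj-take-drop g U)

Sh-unique : ∀ γ w → size γ ≡ length w → Unique w → Unique (Sh γ w)
Sh-unique []      w e U = [] ∷ []
Sh-unique (g ∷ γ) w e U = concatMap-sh-unique (take g w) (Sh-unique γ (drop g w) (size-drop g γ w e) (Uniq.drop⁺ g U))
                            (All.tabulate (Disj-Sh g γ w e U))

-- Blocks of a word

Blocks : Rel ℕ 0ℓ → Comp → List ℕ → Set
Blocks R []      w = ⊤
Blocks R (g ∷ γ) w = AllPairs R (take g w) × Blocks R γ (drop g w)

Blocks-map⁺ : ∀ {R : Rel ℕ 0ℓ} (p : ℕ → ℕ) γ w → Blocks (R on p) γ w → Blocks R γ (map p w)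
Blocks-map⁺ p []      w _ = tt
Blocks-map⁺ {R} p (g ∷ γ) w (r , rs) = subst (AllPairs R) (sym (take-map g w)) (AllPairsP.map⁺ r)
                                 , subst (Blocks R γ) (sym (drop-map g w)) (Blocks-map⁺ p γ (drop g w) rs)

Blocks-map⁻ : ∀ {R : Rel ℕ 0ℓ} (p : ℕ → ℕ) γ w → Blocks R γ (map p w) → Blocks (R on p) γ w
Blocks-map⁻ p []      w _ = tt
Blocks-map⁻ {R} p (g ∷ γ) w (r , rs) = AllPairsP.map⁻ (subst (AllPairs R) (take-map g w) r)
                                 , Blocks-map⁻ p γ (drop g w) (subst (Blocks R γ) (drop-map g w) rs)

≤C-if-cut : ∀ (t : Bool) {m α γ} → IsComp (suc m) α → IsComp (suc m) γ →
            ((if t then 1 ∷ α else inc α) ≤C (1 ∷ γ)) ≡ (α ≤C γ)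
≤C-if-cut true  = ≤C-cut-cut
≤C-if-cut false = ≤C-inc-cut

-- Descents of w may occur only where a block of γ ends, so inside a block adjacent letters
-- increase. In the converse `≤C⇒Blocks` transitivity extends this from adjacent letters to all
-- pairs in the block.
Blocks⇒≤C : ∀ {γ} w → IsComp (length w) γ → Blocks ℕ._≤_ γ w → (D w ≤C γ) ≡ true
Blocks⇒≤C [] nil _ = refl
Blocks⇒≤C (a ∷ []) one _ = refl
Blocks⇒≤C (a ∷ b ∷ w) (cut {x = x} {γ} i) (_ , r) = trans (cong (_≤C (1 ∷ x ∷ γ)) (D-∷ a b w))
  (trans (≤C-if-cut (b <ᵇ a) (D-IsComp (b ∷ w)) i) (Blocks⇒≤C (b ∷ w) i r))
Blocks⇒≤C (a ∷ b ∷ w) (ext {x = x} {γ} i) (r , rs) with IsComp-positive i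
... | z<s ∷ _ with (a≤b ∷ _) ∷ r′ ← r = trans (cong (_≤C (suc x ∷ γ)) (D-∷ a b w))
  (trans (cong (λ t → (if t then 1 ∷ D (b ∷ w) else inc (D (b ∷ w))) ≤C (suc x ∷ γ)) (<ᵇ-false a≤b))
    (trans (≤C-inc-inc (D-IsComp (b ∷ w)) i) (Blocks⇒≤C (b ∷ w) i (r′ , rs))))

≤C⇒Blocks : ∀ {γ} w → IsComp (length w) γ → (D w ≤C γ) ≡ true → Blocks ℕ._≤_ γ w
≤C⇒Blocks [] nil _ = tt
≤C⇒Blocks (a ∷ []) one _ = [] ∷ [] , tt
≤C⇒Blocks (a ∷ b ∷ w) (cut {x = x} {γ} i) e = [] ∷ [] , ≤C⇒Blocks (b ∷ w) i
  (trans (sym (≤C-if-cut (b <ᵇ a) (D-IsComp (b ∷ w)) i)) (trans (cong (_≤C (1 ∷ x ∷ γ)) (sym (D-∷ a b w))) e))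
≤C⇒Blocks (a ∷ b ∷ w) (ext {x = x} {γ} i) e =
  extend (IsComp-positive i) (b <ᵇ a) refl (trans (cong (_≤C (suc x ∷ γ)) (sym (D-∷ a b w))) e) (≤C⇒Blocks (b ∷ w) i)
  where
  extend : Positive (x ∷ γ) → ∀ t → (b <ᵇ a) ≡ t → ((if t then 1 ∷ D (b ∷ w) else inc (D (b ∷ w))) ≤C (suc x ∷ γ)) ≡ true →
           ((D (b ∷ w) ≤C (x ∷ γ)) ≡ true → Blocks ℕ._≤_ (x ∷ γ) (b ∷ w)) → Blocks ℕ._≤_ (suc x ∷ γ) (a ∷ b ∷ w)
  extend _ true _ e _ = contradiction (trans (sym e) (≤C-cut-inc (D-IsComp (b ∷ w)) i)) λ ()
  extend (z<s ∷ _) false eq e ih with r ∷ rs , bs ← ih (trans (sym (≤C-inc-inc (D-IsComp (b ∷ w)) i)) e) =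
    (a≤b ∷ All.map (ℕP.≤-trans a≤b) r) ∷ r ∷ rs , bs
    where
    a≤b : a ℕ.≤ b
    a≤b = false⇒≥ eq

-- Words sorted by a key

module _ (p : ℕ → ℕ) where

  _≼_ : Rel ℕ 0ℓ
  _≼_ = ℕ._≤_ on p

  sorted-↭⇒≡ : ∀ {u v} → (∀ {a b} → a ∈ u → b ∈ u → p a ≡ p b → a ≡ b) →
               AllPairs _≼_ u → AllPairs _≼_ v → u ↭ v → u ≡ v
  sorted-↭⇒≡ {[]} {[]} inj _ _ _ = refl
  sorted-↭⇒≡ {[]} {_ ∷ _} inj _ _ e = contradiction (PermP.↭-length e) λ ()
  sorted-↭⇒≡ {_ ∷ _} {[]} inj _ _ e = contradiction (PermP.↭-length e) λ ()
  sorted-↭⇒≡ {a ∷ u} {b ∷ v} inj (ra ∷ ru) (rb ∷ rv) e with a≡b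
    where
    b∈ : b ∈ a ∷ u
    b∈ = PermP.∈-resp-↭ (↭-sym e) (here refl)
    least : ∀ {a u c} → All (a ≼_) u → c ∈ a ∷ u → a ≼ c
    least r (here refl) = ℕP.≤-refl
    least r (there c∈)  = All.lookup r c∈
    a≡b : a ≡ b
    a≡b = inj (here refl) b∈ (ℕP.≤-antisym (least ra b∈) (least rb (PermP.∈-resp-↭ e (here refl))))
  ... | refl = cong (a ∷_) (sorted-↭⇒≡ (λ c∈ d∈ → inj (there c∈) (there d∈)) ru rv (PermP.drop-∷ e))

  -- The letters of the first block stand in u in sorted order. The block is sorted too and keys are
  -- distinct, so these letters of u spell the block itself. Deleting them leaves a sorted
  -- arrangement of the remaining letters, to which induction applies.
  Blocks⇒∈Sh : ∀ γ {u} w → (∀ {a b} → a ∈ u → b ∈ u → p a ≡ p b → a ≡ b) → Unique w →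
               AllPairs _≼_ u → u ↭ w → size γ ≡ length w → Blocks _≼_ γ w → u ∈ Sh γ w
  Blocks⇒∈Sh []      []      inj U r e _ _ with refl ← PermP.↭-empty-inv e = here refl
  Blocks⇒∈Sh (g ∷ γ) {u} w inj U r e s (r₁ , rs) =
    ∈-concatMap-sh⁺ w₁ (Blocks⇒∈Sh γ w₂ (λ a∈ b∈ → inj (sub₂ a∈) (sub₂ b∈)) (Uniq.drop⁺ g U)
                          (AllPairsP.filter⁺ (λ a → ¬? (a ∈? w₁)) r) e₂ (size-drop g γ w s) rs)
      (interleaving⇒sh (subst (λ v → Interleaving v (filter (λ a → ¬? (a ∈? w₁)) u) u) u₁≡w₁ (interleaving-filter (_∈? w₁) u)))
    where
    w₁ w₂ : List ℕ
    w₁ = take g w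
    w₂ = drop g w
    w₂∉ : All (_∉ w₁) w₂
    w₂∉ = Disj-∉ (Disj-take-drop g U)
    filter-w : ∀ {P : Pred ℕ 0ℓ} (P? : Unary.Decidable P) → filter P? w ≡ filter P? w₁ ++ filter P? w₂
    filter-w P? = trans (cong (filter P?) (sym (take++drop≡id g w))) (filter-++ P? w₁ w₂)
    e₁ : filter (_∈? w₁) u ↭ w₁
    e₁ = ↭-trans (PermP.filter-↭ (_∈? w₁) e) (↭-reflexive (trans (filter-w (_∈? w₁))
      (trans (cong₂ _++_ (filter-all (_∈? w₁) (All.tabulate id)) (filter-none (_∈? w₁) w₂∉)) (++-identityʳ w₁))))
    e₂ : filter (λ a → ¬? (a ∈? w₁)) u ↭ w₂
    e₂ = ↭-trans (PermP.filter-↭ (λ a → ¬? (a ∈? w₁)) e) (↭-reflexive (trans (filter-w (λ a → ¬? (a ∈? w₁)))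
      (cong₂ _++_ (filter-none (λ a → ¬? (a ∈? w₁)) (All.tabulate {xs = w₁} (λ a∈ a∉ → a∉ a∈)))
                  (filter-all (λ a → ¬? (a ∈? w₁)) w₂∉))))
    sub₁ : ∀ {a} → a ∈ filter (_∈? w₁) u → a ∈ u
    sub₁ a∈ = proj₁ (∈-filter⁻ (_∈? w₁) a∈)
    sub₂ : ∀ {a} → a ∈ filter (λ a → ¬? (a ∈? w₁)) u → a ∈ u
    sub₂ a∈ = proj₁ (∈-filter⁻ (λ a → ¬? (a ∈? w₁)) a∈)
    u₁≡w₁ : filter (_∈? w₁) u ≡ w₁
    u₁≡w₁ = sorted-↭⇒≡ (λ a∈ b∈ → inj (sub₁ a∈) (sub₁ b∈)) (AllPairsP.filter⁺ (_∈? w₁) r) r₁ e₁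

  -- Each block is a subword of the shuffle u and inherits its order.
  ∈Sh⇒Blocks : ∀ γ {u} w → AllPairs _≼_ u → u ∈ Sh γ w → Blocks _≼_ γ w
  ∈Sh⇒Blocks []      w r u∈ = tt
  ∈Sh⇒Blocks (g ∷ γ) w r u∈ with v , v∈ , u∈′ ← ∈-concatMap-sh⁻ (take g w) u∈
    with r₁ , r₂ ← interleaving-AllPairs (sh⇒interleaving (take g w) v u∈′) r =
    r₁ , ∈Sh⇒Blocks γ (drop g w) r₂ v∈

-- Permutations in one-line notation

-- Inserting a letter in all places is shuffling with a one-letter word. So results on shuffles
-- apply to `perms`, and multiplication by F_(1) runs over insertions.
insertAll-unique : ∀ x (f : List ℕ → List (List ℕ)) → f [] ≡ (x ∷ []) ∷ [] →
                   (∀ y ys → f (y ∷ ys) ≡ (x ∷ y ∷ ys) ∷ map (y ∷_) (f ys)) →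
                   ∀ ys → f ys ≡ sh (x ∷ []) ys
insertAll-unique x f p q []       = p
insertAll-unique x f p q (y ∷ ys) = trans (q y ys) (cong (λ L → (x ∷ y ∷ ys) ∷ map (y ∷_) L) (insertAll-unique x f p q ys))

perms-suc : ∀ n → perms (suc n) ≡ concatMap (sh (suc n ∷ [])) (perms n)
perms-suc n = cong concat (map-cong (insertAll-unique (suc n) _ refl (λ _ _ → refl)) (perms n))

∈oneTo⁻ : ∀ n {j} → j ∈ oneTo n → ∃ λ i → j ≡ suc i × i ℕ.< n
∈oneTo⁻ (suc n) j∈ with ∈-++⁻ (oneTo n) j∈
... | inj₁ p with i , e , i< ← ∈oneTo⁻ n p = i , e , ℕP.m<n⇒m<1+n i<
... | inj₂ (here refl) = n , refl , ℕP.n<1+n n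

∈oneTo⁺ : ∀ n {i} → i ℕ.< n → suc i ∈ oneTo n
∈oneTo⁺ (suc n) {i} (s≤s i≤n) with i ℕ.≟ n
... | yes refl = ∈-++⁺ʳ (oneTo n) (here refl)
... | no i≢n   = ∈-++⁺ˡ (∈oneTo⁺ n (ℕP.≤∧≢⇒< i≤n i≢n))

oneTo-sorted : ∀ n → AllPairs ℕ._<_ (oneTo n)
oneTo-sorted zero    = []
oneTo-sorted (suc n) = subst (AllPairs ℕ._<_) (sym (oneTo-suc n))
  (AllP.map⁺ (All.map (λ p → s<s p) (oneTo-positive n)) ∷ AllPairsP.map⁺ (AllPairs.map s<s (oneTo-sorted n)))

oneTo-unique : ∀ n → Unique (oneTo n)
oneTo-unique n = AllPairs.map ℕP.<⇒≢ (oneTo-sorted n)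

length-oneTo : ∀ n → length (oneTo n) ≡ n
length-oneTo zero    = refl
length-oneTo (suc n) = trans (length-++ (oneTo n)) (trans (ℕP.+-comm (length (oneTo n)) 1) (cong suc (length-oneTo n)))

∈perms⇒↭ : ∀ n {w} → w ∈ perms n → w ↭ oneTo n
∈perms⇒↭ zero    (here refl) = ↭-refl
∈perms⇒↭ (suc n) w∈ with v , v∈ , w∈′ ← ∈-concatMap-sh⁻ (suc n ∷ []) (subst (_ ∈_) (perms-suc n) w∈) =
  ↭-trans (toPermutation (sh⇒interleaving (suc n ∷ []) v w∈′))
    (↭-trans (↭-prep (suc n) (∈perms⇒↭ n v∈)) (PermP.∷↭∷ʳ (suc n) (oneTo n)))

∈sh-middle : ∀ x u v → u ++ x ∷ v ∈ sh (x ∷ []) (u ++ v)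
∈sh-middle x u v = interleaving⇒sh (go u)
  where
  go : ∀ u → Interleaving (x ∷ []) (u ++ v) (u ++ x ∷ v)
  go []      = consˡ (interleaving-[]ˡ v)
  go (_ ∷ u) = consʳ (go u)

↭⇒∈perms : ∀ n {w} → w ↭ oneTo n → w ∈ perms n
↭⇒∈perms zero    e with refl ← PermP.↭-empty-inv e = here refl
-- The letter n + 1 occurs in the word; deleting it leaves a rearrangement of 1, ..., n, and the
-- word arises by inserting it again.
↭⇒∈perms (suc n) e with u , v , refl ← ∈-∃++ (PermP.∈-resp-↭ (↭-sym e) (∈-++⁺ʳ (oneTo n) (here refl))) =
  subst (u ++ suc n ∷ v ∈_) (sym (perms-suc n)) (∈-concatMap-sh⁺ (suc n ∷ [])
    (↭⇒∈perms n (↭-trans (PermP.drop-mid u (oneTo n) e) (↭-reflexive (++-identityʳ (oneTo n)))))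
    (∈sh-middle (suc n) u v))

Disj-new : ∀ n {w} → w ∈ perms n → Disj (suc n ∷ []) w
Disj-new n w∈ = PermP.All-resp-↭ (↭-sym (∈perms⇒↭ n w∈)) (All.tabulate fresh) ∷ []
  where
  fresh : ∀ {j} → j ∈ oneTo n → suc n ≢ j
  fresh j∈ refl with _ , refl , n<n ← ∈oneTo⁻ n j∈ = ℕP.<-irrefl refl n<n

perms-unique : ∀ n → Unique (perms n)
perms-unique zero    = [] ∷ []
perms-unique (suc n) = subst Unique (sym (perms-suc n))
  (concatMap-sh-unique (suc n ∷ []) (perms-unique n) (All.tabulate (Disj-new n)))

idx : ℕ → List ℕ → ℕ
idx j []       = 0
idx j (x ∷ xs) = if j ≡ᵇ x then 1 else suc (idx j xs)

indexOf-unique : ∀ j (f : List ℕ → ℕ) → f [] ≡ 0 → (∀ x xs → f (x ∷ xs) ≡ (if j ≡ᵇ x then 1 else suc (f xs))) →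
                 ∀ xs → f xs ≡ idx j xs
indexOf-unique j f p q []       = p
indexOf-unique j f p q (x ∷ xs) = trans (q x xs) (cong (λ i → if j ≡ᵇ x then 1 else suc i) (indexOf-unique j f p q xs))

mutual
  inv-idx : ∀ σ → inv σ ≡ map (λ j → idx j σ) (oneTo (length σ))
  inv-idx σ = map-cong (λ j → indexOf-is j σ) (oneTo (length σ))

  indexOf-is : ∀ j xs → _ ≡ idx j xs
  indexOf-is j = indexOf-unique j _ refl (λ _ _ → refl)

idx-positive : ∀ j x xs → ∃ λ i → idx j (x ∷ xs) ≡ suc i
idx-positive j x xs with j ≡ᵇ x
... | true  = 0 , refl
... | false = idx j xs , refl

≡ᵇ-refl : ∀ j → (j ≡ᵇ j) ≡ true
≡ᵇ-refl zero    = refl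
≡ᵇ-refl (suc j) = ≡ᵇ-refl j

≢⇒≡ᵇ-false : ∀ {i j} → i ≢ j → (i ≡ᵇ j) ≡ false
≢⇒≡ᵇ-false {i} {j} i≢j with i ≡ᵇ j in eq
... | true  = contradiction (ℕP.≡ᵇ⇒≡ i j (subst T (sym eq) tt)) i≢j
... | false = refl

idx-bounded : ∀ {j} σ → j ∈ σ → ∃ λ i → idx j σ ≡ suc i × i ℕ.< length σ
idx-bounded {j} (x ∷ σ) j∈ with j ≡ᵇ x in eq
... | true  = 0 , refl , z<s
idx-bounded {j} (x ∷ σ) (here refl) | false = contradiction (trans (sym (≡ᵇ-refl j)) eq) λ ()
idx-bounded {j} (x ∷ σ) (there j∈) | false with i , e , i< ← idx-bounded σ j∈ = suc i , cong suc e , s<s i<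

at-idx : ∀ {j} σ → j ∈ σ → at σ (idx j σ) ≡ j
at-idx {j} (x ∷ σ) j∈ with j ≡ᵇ x in eq
... | true = sym (ℕP.≡ᵇ⇒≡ j x (subst T (sym eq) tt))
at-idx {j} (x ∷ σ) (here refl) | false = contradiction (trans (sym (≡ᵇ-refl j)) eq) λ ()
at-idx {j} (x ∷ y ∷ σ) (there j∈) | false with i , e ← idx-positive j y σ =
  trans (cong (λ k → at (x ∷ y ∷ σ) (suc k)) e) (trans (cong (at (y ∷ σ)) (sym e)) (at-idx (y ∷ σ) j∈))

at-∈ : ∀ σ {i} → i ℕ.< length σ → at σ (suc i) ∈ σ
at-∈ (x ∷ σ) {zero}  _       = here refl
at-∈ (x ∷ σ) {suc i} (s≤s l) = there (at-∈ σ l)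

idx-at : ∀ {σ i} → Unique σ → i ℕ.< length σ → idx (at σ (suc i)) σ ≡ suc i
idx-at {x ∷ σ} {zero}  _        _       rewrite ≡ᵇ-refl x = refl
idx-at {x ∷ σ} {suc i} (x∉ ∷ U) (s≤s l)
  rewrite ≢⇒≡ᵇ-false (≢-sym (All.lookup x∉ (at-∈ σ l))) = cong suc (idx-at U l)

at-map : ∀ f xs {i} → i ℕ.< length xs → at (map f xs) (suc i) ≡ f (at xs (suc i))
at-map f (x ∷ xs) {zero}  _       = refl
at-map f (x ∷ xs) {suc i} (s≤s l) = at-map f xs l

map-at-oneTo : ∀ σ → map (at σ) (oneTo (length σ)) ≡ σ
map-at-oneTo []      = refl
map-at-oneTo (x ∷ σ) = begin
  map (at (x ∷ σ)) (oneTo (suc (length σ)))           ≡⟨ cong (map (at (x ∷ σ))) (oneTo-suc (length σ)) ⟩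
  x ∷ map (at (x ∷ σ)) (map suc (oneTo (length σ)))   ≡⟨ cong (x ∷_) (map-∘ (oneTo (length σ))) ⟨
  x ∷ map (λ i → at (x ∷ σ) (suc i)) (oneTo (length σ)) ≡⟨ cong (x ∷_) (map-cong-local (All.map (λ { z<s → refl }) (oneTo-positive (length σ)))) ⟩
  x ∷ map (at σ) (oneTo (length σ))                   ≡⟨ cong (x ∷_) (map-at-oneTo σ) ⟩
  x ∷ σ                                               ∎
  where open ≡-Reasoning

at-oneTo : ∀ n {i} → i ℕ.< n → at (oneTo n) (suc i) ≡ suc i
at-oneTo (suc n) {zero}  _       rewrite oneTo-suc n = refl
at-oneTo (suc n) {suc i} (s≤s l) rewrite oneTo-suc n =
  trans (at-map suc (oneTo n) (subst (i ℕ.<_) (sym (length-oneTo n)) l)) (cong suc (at-oneTo n l))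

module Permutation {n σ} (σ∈ : σ ∈ perms n) where

  σ↭ : σ ↭ oneTo n
  σ↭ = ∈perms⇒↭ n σ∈

  length-σ : length σ ≡ n
  length-σ = trans (PermP.↭-length σ↭) (length-oneTo n)

  σ-unique : Unique σ
  σ-unique = Unique-resp-↭ (↭-sym σ↭) (oneTo-unique n)

  inv-σ : inv σ ≡ map (λ j → idx j σ) (oneTo n)
  inv-σ = trans (inv-idx σ) (cong (λ k → map (λ j → idx j σ) (oneTo k)) length-σ)

  ∈σ : ∀ {j} → j ∈ oneTo n → j ∈ σ
  ∈σ = PermP.∈-resp-↭ (↭-sym σ↭)

  at-inv : map (at σ) (inv σ) ≡ oneTo n
  at-inv = trans (cong (map (at σ)) inv-σ) (trans (sym (map-∘ (oneTo n)))
    (map-id-local (All.tabulate (λ j∈ → at-idx σ (∈σ j∈)))))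

  idx-at-σ : ∀ {i} → i ℕ.< n → idx (at σ (suc i)) σ ≡ suc i
  idx-at-σ {i} i< = idx-at σ-unique (subst (i ℕ.<_) (sym length-σ) i<)

  at-σ-∈ : ∀ {i} → i ℕ.< n → at σ (suc i) ∈ oneTo n
  at-σ-∈ {i} i< = PermP.∈-resp-↭ σ↭ (at-∈ σ (subst (i ℕ.<_) (sym length-σ) i<))

  at-injective : ∀ {a b} → a ∈ oneTo n → b ∈ oneTo n → at σ a ≡ at σ b → a ≡ b
  at-injective a∈ b∈ e with i , refl , i< ← ∈oneTo⁻ n a∈ | j , refl , j< ← ∈oneTo⁻ n b∈ =
    trans (sym (idx-at-σ i<)) (trans (cong (λ k → idx k σ) e) (idx-at-σ j<))

  inv-↭ : inv σ ↭ oneTo n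
  inv-↭ = unique-⊆⊇⇒↭ (Uniq.map⁻ {f = at σ} (subst Unique (sym at-inv) (oneTo-unique n))) (oneTo-unique n) to from
    where
    to : ∀ {j} → j ∈ inv σ → j ∈ oneTo n
    to j∈ with k , k∈ , refl ← ∈-map⁻ (λ j → idx j σ) (subst (_ ∈_) inv-σ j∈)
      with i , e , i< ← idx-bounded σ (∈σ k∈) =
      subst (_∈ oneTo n) (sym e) (∈oneTo⁺ n (subst (i ℕ.<_) length-σ i<))
    from : ∀ {j} → j ∈ oneTo n → j ∈ inv σ
    from j∈ with i , refl , i< ← ∈oneTo⁻ n j∈ =
      subst (_ ∈_) (sym inv-σ) (subst (_∈ map (λ j → idx j σ) (oneTo n)) (idx-at-σ i<) (∈-map⁺ (λ j → idx j σ) (at-σ-∈ i<)))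

  inv-∈perms : inv σ ∈ perms n
  inv-∈perms = ↭⇒∈perms n inv-↭

  -- Applying σ to the letters of its inverse gives 1, ..., n, so the inverse is the arrangement
  -- sorted by the key `at σ`.
  inv-sorted : AllPairs (ℕ._≤_ on at σ) (inv σ)
  inv-sorted = AllPairsP.map⁻ (subst (AllPairs ℕ._≤_) (sym at-inv) (AllPairs.map ℕP.<⇒≤ (oneTo-sorted n)))

  ∘-∈perms : ∀ {π} → π ∈ perms n → σ ∘ₚ π ∈ perms n
  ∘-∈perms π∈ = ↭⇒∈perms n (↭-trans (PermP.map⁺ (at σ) (∈perms⇒↭ n π∈))
    (↭-trans (↭-reflexive (trans (cong (map (at σ) ∘ oneTo) (sym length-σ)) (map-at-oneTo σ))) σ↭))

inv-involutive : ∀ {n σ} → σ ∈ perms n → inv (inv σ) ≡ σ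
inv-involutive {n} {σ} σ∈ = begin
  inv u                        ≡⟨ V.inv-σ ⟩
  map (λ j → idx j u) (oneTo n) ≡⟨ map-cong-local (All.tabulate pointwise) ⟩
  map (at σ) (oneTo n)         ≡⟨ cong (map (at σ) ∘ oneTo) (sym P.length-σ) ⟩
  map (at σ) (oneTo (length σ)) ≡⟨ map-at-oneTo σ ⟩
  σ                            ∎
  where
  open ≡-Reasoning
  module P = Permutation {n} σ∈
  u : List ℕ
  u = inv σ
  module V = Permutation {n} P.inv-∈perms
  at-u : ∀ {k} → k ℕ.< n → at u (suc k) ≡ idx (suc k) σ
  at-u {k} k< = trans (cong (λ v → at v (suc k)) P.inv-σ)
    (trans (at-map (λ j → idx j σ) (oneTo n) (subst (k ℕ.<_) (sym (length-oneTo n)) k<)) (cong (λ j → idx j σ) (at-oneTo n k<)))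
  pointwise : ∀ {j} → j ∈ oneTo n → idx j u ≡ at σ j
  pointwise {j} j∈ with i , refl , i< ← ∈oneTo⁻ n j∈ with k , e , k< ← ∈oneTo⁻ n (P.at-σ-∈ i<) = begin
    idx (suc i) u                 ≡⟨ cong (λ j → idx j u) (P.idx-at-σ i<) ⟨
    idx (idx (at σ (suc i)) σ) u  ≡⟨ cong (λ j → idx (idx j σ) u) e ⟩
    idx (idx (suc k) σ) u         ≡⟨ cong (λ j → idx j u) (at-u k<) ⟨
    idx (at u (suc k)) u          ≡⟨ V.idx-at-σ k< ⟩
    suc k                         ≡⟨ e ⟨
    at σ (suc i)                  ∎

-- u = σ⁻¹ lists the letters in increasing order of σ, so it is a shuffle of the blocks of π
-- exactly when σ is increasing along each block.
inverses-↭-Sh : ∀ {n π γ} → π ∈ perms n → IsComp n γ →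
  map inv (filter (λ σ → (D (σ ∘ₚ π) ≤C γ) Bool.≟ true) (perms n)) ↭ Sh γ π
inverses-↭-Sh {n} {π} {γ} π∈ iγ = unique-⊆⊇⇒↭ unique (Sh-unique γ π sizes Pπ.σ-unique) to from
  where
  module Pπ = Permutation {n} π∈
  good? : ∀ σ → _
  good? σ = (D (σ ∘ₚ π) ≤C γ) Bool.≟ true
  sizes : size γ ≡ length π
  sizes = trans (IsComp-size iγ) (sym Pπ.length-σ)
  iπ : ∀ σ → IsComp (length (σ ∘ₚ π)) γ
  iπ σ = subst (λ m → IsComp m γ) (sym (trans (length-map (at σ) π) Pπ.length-σ)) iγ
  unique : Unique (map inv (filter good? (perms n)))
  unique = Uniq.map⁻ {f = inv} (subst Unique (sym restore) (Uniq.filter⁺ good? (perms-unique n)))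
    where
    restore : map inv (map inv (filter good? (perms n))) ≡ filter good? (perms n)
    restore = trans (sym (map-∘ (filter good? (perms n))))
      (map-id-local (All.tabulate (λ σ∈ → inv-involutive {n} (proj₁ (∈-filter⁻ good? {xs = perms n} σ∈)))))
  to : ∀ {u} → u ∈ map inv (filter good? (perms n)) → u ∈ Sh γ π
  to u∈ with σ , σ∈ , refl ← ∈-map⁻ inv u∈ with σ∈ , good ← ∈-filter⁻ good? {xs = perms n} σ∈ =
    Blocks⇒∈Sh (at σ) γ π (λ a∈ b∈ → P.at-injective (PermP.∈-resp-↭ P.inv-↭ a∈) (PermP.∈-resp-↭ P.inv-↭ b∈))
      Pπ.σ-unique P.inv-sorted (↭-trans P.inv-↭ (↭-sym Pπ.σ↭)) sizes
      (Blocks-map⁻ (at σ) γ π (≤C⇒Blocks (σ ∘ₚ π) (iπ σ) good))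
    where module P = Permutation {n} σ∈
  from : ∀ {u} → u ∈ Sh γ π → u ∈ map inv (filter good? (perms n))
  from {u} u∈ = subst (_∈ map inv (filter good? (perms n))) (inv-involutive {n} u∈perms)
    (∈-map⁺ inv (∈-filter⁺ good? σ∈ (Blocks⇒≤C (σ ∘ₚ π) (iπ σ) (Blocks-map⁺ (at σ) γ π
      (∈Sh⇒Blocks (at σ) γ π (subst (AllPairs _) (inv-involutive {n} u∈perms) (Permutation.inv-sorted {n} σ∈)) u∈)))))
    where
    u∈perms : u ∈ perms n
    u∈perms = ↭⇒∈perms n (↭-trans (Sh-↭ γ π sizes u∈) Pπ.σ↭)
    σ : List ℕ
    σ = inv u
    σ∈ : σ ∈ perms n
    σ∈ = Permutation.inv-∈perms {n} u∈perms

D-map-suc : ∀ w → D (map suc w) ≡ D w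
D-map-suc []          = refl
D-map-suc (a ∷ [])    = refl
D-map-suc (a ∷ b ∷ w) = begin
  D (map suc (a ∷ b ∷ w))                                                     ≡⟨ D-∷ (suc a) (suc b) (map suc w) ⟩
  (if b <ᵇ a then 1 ∷ D (map suc (b ∷ w)) else inc (D (map suc (b ∷ w))))     ≡⟨ cong (λ α → if b <ᵇ a then 1 ∷ α else inc α) (D-map-suc (b ∷ w)) ⟩
  (if b <ᵇ a then 1 ∷ D (b ∷ w) else inc (D (b ∷ w)))                         ≡⟨ D-∷ a b w ⟨
  D (a ∷ b ∷ w)                                                               ∎
  where open ≡-Reasoning

-- A largest letter put in front creates a descent at 1; a smallest one, after raising the others by
-- 1, creates none. This carries statements about compositions over to permutations.
D-surjective : ∀ {n α} → IsComp n α → ∃ λ π → π ∈ perms n × D π ≡ α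
D-surjective nil = [] , here refl , refl
D-surjective one = 1 ∷ [] , here refl , refl
D-surjective (cut {m} {x} {α} i) with D-surjective i
... | [] , _ , ()
... | b ∷ w , π∈ , e = suc (suc m) ∷ b ∷ w , ↭⇒∈perms (suc (suc m)) π↭ , trans (D-∷ (suc (suc m)) b w)
  (trans (cong (λ t → if t then 1 ∷ D (b ∷ w) else inc (D (b ∷ w))) (<ᵇ-true b<)) (cong (1 ∷_) e))
  where
  π↭ : suc (suc m) ∷ b ∷ w ↭ oneTo (suc (suc m))
  π↭ = ↭-trans (↭-prep _ (∈perms⇒↭ (suc m) π∈)) (PermP.∷↭∷ʳ (suc (suc m)) (oneTo (suc m)))
  b< : b ℕ.< suc (suc m)
  b< with k , refl , k< ← ∈oneTo⁻ (suc m) (PermP.∈-resp-↭ (∈perms⇒↭ (suc m) π∈) (here refl)) = s<s k<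
D-surjective (ext {m} {x} {α} i) with D-surjective i
... | [] , _ , ()
... | b ∷ w , π∈ , e = 1 ∷ map suc (b ∷ w) , ↭⇒∈perms (suc (suc m)) π↭ ,
  trans (D-∷ 1 (suc b) (map suc w)) (cong inc (trans (D-map-suc (b ∷ w)) e))
  where
  π↭ : 1 ∷ map suc (b ∷ w) ↭ oneTo (suc (suc m))
  π↭ = ↭-trans (↭-prep 1 (PermP.map⁺ suc (∈perms⇒↭ (suc m) π∈))) (↭-reflexive (sym (oneTo-suc (suc m))))

-- Total reciprocals and signs

recip : ℚ → ℚ
recip q with q ℚP.≟ 0ℚ
... | yes _  = 0ℚ
... | no q≢0 = 1/_ q {{≢-nonZero q≢0}}

-- Both sides vanish for q = 0, so a division can be moved through sums as a fixed factor, with no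
-- case distinction.
/′-recip : ∀ p q → p /′ q ≡ p * recip q
/′-recip p q with q ℚP.≟ 0ℚ
... | yes _  = sym (ℚP.*-zeroʳ p)
... | no q≢0 = refl

*-recip : ∀ {q} → q ≢ 0ℚ → q * recip q ≡ 1ℚ
*-recip {q} q≢0 with q ℚP.≟ 0ℚ
... | yes q≡0 = contradiction q≡0 q≢0
... | no q≢0  = ℚP.*-inverseʳ q {{≢-nonZero q≢0}}

recip-≥0 : ∀ {q} → 0ℚ < q → 0ℚ ≤ recip q
recip-≥0 {q} q>0 with q ℚP.≟ 0ℚ
... | yes _  = ℚP.≤-refl
... | no q≢0 = ℚP.<⇒≤ (ℚP.positive⁻¹ (1/_ q {{≢-nonZero q≢0}}) {{ℚP.1/pos⇒pos q {{positive q>0}}}})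

*-≥0 : ∀ {p q} → 0ℚ ≤ p → 0ℚ ≤ q → 0ℚ ≤ p * q
*-≥0 {p} {q} p≥0 q≥0 = subst (_≤ p * q) (ℚP.*-zeroʳ p) (ℚP.*-monoˡ-≤-nonNeg p {{nonNegative p≥0}} q≥0)

[]·-≥0 : ∀ b {q} → 0ℚ ≤ q → 0ℚ ≤ [ b ]· q
[]·-≥0 true  q≥0 = q≥0
[]·-≥0 false _   = ℚP.≤-refl

==-sym : ∀ α β → (α == β) ≡ (β == α)
==-sym α β with ≡-dec ℕ._≟_ α β
... | yes α≡β = sym (==-≡ (sym α≡β))
... | no α≢β  = sym (==-≢ (≢-sym α≢β))

∑-δˡ : ∀ {xs : List Comp} {γ} (f : Comp → ℚ) → Unique xs → γ ∈ xs → ∑ xs (λ β → [ γ == β ]· f β) ≡ f γ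
∑-δˡ {xs} {γ} f U γ∈ = trans (∑-cong xs (λ β → cong (λ b → [ b ]· f β) (==-sym γ β))) (∑-δ f U γ∈)

[]·-comm : ∀ b c q → [ b ]· [ c ]· q ≡ [ c ]· [ b ]· q
[]·-comm true  true  q = refl
[]·-comm true  false q = refl
[]·-comm false true  q = refl
[]·-comm false false q = refl

-- The matrix of the endomorphism in the fundamental basis

module Matrix (Φ : Endo) (hopf : IsHopfEndo Φ) where
  open Hopf Φ hopf

  -- X w and Y w γ are the coefficients of M_(n) and of M_γ in Φ(F_{D(w)}), where n is the length of w.
  X : List ℕ → ℚ
  X w = ∑ (E w) χ

  Y : List ℕ → Comp → ℚ
  Y w γ = ∑ (E w) (λ β → Φ β γ)

  X-Y : ∀ w → X w ≡ Y w (top (length w))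
  X-Y w = ∑-cong∈ (E w) (λ {β} β∈ → cong (λ m → Φ β (top m)) (IsComp-size (E-IsComp w β∈)))

  X-[_] : ∀ a → X (a ∷ []) ≡ lam Φ
  X-[ a ] = ℚP.+-identityʳ _

  X-sh : ∀ {u v} → Disj u v → ∑ (sh u v) X ≡ X u * X v
  X-sh {u} {v} d = begin
    ∑ (sh u v) X                                      ≡⟨ E-sh u v d χ ⟩
    ∑ (E u) (λ α → ∑ (E v) (λ β → ∑ (qsh α β) χ))     ≡⟨ ∑-cong∈ (E u) (λ α∈ → ∑-cong∈ (E v) (λ β∈ →
                                                           χ-mult (IsComp-positive (E-IsComp u α∈)) (IsComp-positive (E-IsComp v β∈)))) ⟩
    ∑ (E u) (λ α → ∑ (E v) (λ β → χ α * χ β))         ≡⟨ ∑-*-∑ (E u) (E v) χ χ ⟨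
    X u * X v                                         ∎
    where open ≡-Reasoning

  -- `χ-split` evaluates the left tensor factor by χ, and `∑-E-cutAt` cuts F_{D(w)} at the same
  -- place.
  Y-∷ : ∀ {g γ} w → IsComp (length w) (g ∷ γ) → Y w (g ∷ γ) ≡ X (take g w) * Y (drop g w) γ
  Y-∷ {zero}      w i with () ∷ _ ← IsComp-positive i
  Y-∷ {suc g} {γ} w i with _ ∷ pγ ← IsComp-positive i = begin
    Y w (suc g ∷ γ)
      ≡⟨ ∑-cong∈ (E w) (λ β∈ → χ-split g (E-IsComp w β∈) (positive⇒IsComp pγ) i) ⟩
    ∑ (E w) (cutAt (suc g) χ (λ β → Φ β γ))
      ≡⟨ ∑-E-cutAt w (suc g) χ (λ β → Φ β γ) (subst (suc g ℕ.≤_) (IsComp-size i) (ℕP.m≤m+n (suc g) (size γ))) ⟩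
    X (take (suc g) w) * Y (drop (suc g) w) γ ∎
    where open ≡-Reasoning

  IsComp-drop : ∀ {g γ} (w : List ℕ) → IsComp (length w) (g ∷ γ) → IsComp (length (drop g w)) γ
  IsComp-drop {g} {γ} w i with _ ∷ pγ ← IsComp-positive i =
    subst (λ m → IsComp m γ) (size-drop g γ w (IsComp-size i)) (positive⇒IsComp pγ)

  Y-Sh : ∀ γ w → IsComp (length w) γ → Unique w → Y w γ ≡ ∑ (Sh γ w) X
  Y-Sh []      []  _ _ = sym (ℚP.+-identityʳ _)
  Y-Sh (g ∷ γ) w i U = begin
    Y w (g ∷ γ)
      ≡⟨ Y-∷ w i ⟩
    X (take g w) * Y (drop g w) γ
      ≡⟨ cong (X (take g w) *_) (Y-Sh γ (drop g w) (IsComp-drop w i) (Uniq.drop⁺ g U)) ⟩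
    X (take g w) * ∑ (Sh γ (drop g w)) X
      ≡⟨ *-∑ (X (take g w)) (Sh γ (drop g w)) X ⟩
    ∑ (Sh γ (drop g w)) (λ v → X (take g w) * X v)
      ≡⟨ ∑-cong∈ (Sh γ (drop g w)) (λ v∈ → X-sh (Disj-Sh g γ w (IsComp-size i) U v∈)) ⟨
    ∑ (Sh γ (drop g w)) (λ v → ∑ (sh (take g w) v) X)
      ≡⟨ ∑-concatMap (sh (take g w)) (Sh γ (drop g w)) X ⟨
    ∑ (Sh (g ∷ γ) w) X ∎
    where open ≡-Reasoning

  -- Every block is a single letter and contributes one factor λ.
  Y-ones : ∀ w → Y w (replicate (length w) 1) ≡ powℚ (lam Φ) (length w)
  Y-ones []      = trans (ℚP.+-identityʳ _) χ-[]
  Y-ones (a ∷ w) = trans (Y-∷ (a ∷ w) (ones-IsComp (suc (length w)))) (cong₂ _*_ X-[ a ] (Y-ones w))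

  -- The one-letter word n + 1 contributes λ, and shuffling it into all permutations of 1, ..., n is
  -- how `perms` grows.
  ∑-perms-X : ∀ n → ∑ (perms n) X ≡ powℚ (lam Φ) n
  ∑-perms-X zero    = trans (ℚP.+-identityʳ _) (trans (ℚP.+-identityʳ _) χ-[])
  ∑-perms-X (suc n) = begin
    ∑ (perms (suc n)) X                                       ≡⟨ cong (λ L → ∑ L X) (perms-suc n) ⟩
    ∑ (concatMap (sh (suc n ∷ [])) (perms n)) X               ≡⟨ ∑-concatMap (sh (suc n ∷ [])) (perms n) X ⟩
    ∑ (perms n) (λ w → ∑ (sh (suc n ∷ []) w) X)               ≡⟨ ∑-cong∈ (perms n) (λ w∈ → X-sh (Disj-new n w∈)) ⟩
    ∑ (perms n) (λ w → X (suc n ∷ []) * X w)                  ≡⟨ *-∑ (X (suc n ∷ [])) (perms n) X ⟨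
    X (suc n ∷ []) * ∑ (perms n) X                            ≡⟨ cong₂ _*_ X-[ suc n ] (∑-perms-X n) ⟩
    lam Φ * powℚ (lam Φ) n                                    ∎
    where open ≡-Reasoning

  module Degree (n : ℕ) (c : Comp → Comp → ℚ)
    (expand : ∀ {α} → α ∈ comps n → ∀ γ →
       coef (apply Φ (F α)) γ ≡ coef (concatMap (λ β → scale (c α β) (F β)) (comps n)) γ) where

    ∑-F : ∀ α f → ∑ (F α) f ≡ ∑ (comps (size α)) (λ β → [ α ≤C β ]· f (1ℚ , β))
    ∑-F α f = trans (∑-map (1ℚ ,_) (filter (λ β → (α ≤C β) Bool.≟ true) (comps (size α))) f) (∑-filter (α ≤C_) (comps (size α)) _)

    -- Two computations of the coefficient of M_γ in Φ(F_α): from the expansion of the image in the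
    -- F, and from the expansion of F_α in the M before Φ is applied.
    lower-c : ∀ {α γ} → IsComp n α → IsComp n γ →
              lower n (c α) γ ≡ ∑ (comps n) (λ β → [ α ≤C β ]· Φ β γ)
    lower-c {α} {γ} iα iγ = begin
      lower n (c α) γ
        ≡⟨ ∑-cong∈ (comps n) (λ β∈ → sym (coefF (c α _) (∈comps⇒IsComp n β∈))) ⟩
      ∑ (comps n) (λ β → coef (scale (c α β) (F β)) γ)
        ≡⟨ ∑-concatMap (λ β → scale (c α β) (F β)) (comps n) (λ p → [ proj₂ p == γ ]· proj₁ p) ⟨
      coef (concatMap (λ β → scale (c α β) (F β)) (comps n)) γ
        ≡⟨ expand (IsComp⇒∈comps iα) γ ⟨
      coef (apply Φ (F α)) γ
        ≡⟨ coef-apply Φ (F α) γ ⟩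
      ∑ (F α) (λ p → proj₁ p * coef (applyM Φ (proj₂ p)) γ)
        ≡⟨ ∑-F α (λ p → proj₁ p * coef (applyM Φ (proj₂ p)) γ) ⟩
      ∑ (comps (size α)) (λ β → [ α ≤C β ]· 1ℚ * coef (applyM Φ β) γ)
        ≡⟨ cong (λ m → ∑ (comps m) (λ β → [ α ≤C β ]· 1ℚ * coef (applyM Φ β) γ)) (IsComp-size iα) ⟩
      ∑ (comps n) (λ β → [ α ≤C β ]· 1ℚ * coef (applyM Φ β) γ)
        ≡⟨ ∑-cong∈ (comps n) (λ {β} β∈ → cong (λ q → [ α ≤C β ]· q)
             (trans (ℚP.*-identityˡ _) (coef-applyM Φ (∈comps-size β∈) iγ))) ⟩
      ∑ (comps n) (λ β → [ α ≤C β ]· Φ β γ) ∎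
      where
      open ≡-Reasoning
      coefF : ∀ q {β} → IsComp n β → coef (scale q (F β)) γ ≡ [ β ≤C γ ]· q
      coefF q {β} iβ = begin
        coef (scale q (F β)) γ
          ≡⟨ coef-scale q (F β) γ ⟩
        q * coef (F β) γ
          ≡⟨ cong (q *_) (∑-F β (λ p → [ proj₂ p == γ ]· proj₁ p)) ⟩
        q * ∑ (comps (size β)) (λ δ → [ β ≤C δ ]· [ δ == γ ]· 1ℚ)
          ≡⟨ cong (λ m → q * ∑ (comps m) (λ δ → [ β ≤C δ ]· [ δ == γ ]· 1ℚ)) (IsComp-size iβ) ⟩
        q * ∑ (comps n) (λ δ → [ β ≤C δ ]· [ δ == γ ]· 1ℚ)
          ≡⟨ cong (q *_) (∑-cong (comps n) (λ δ → []·-comm (β ≤C δ) (δ == γ) 1ℚ)) ⟩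
        q * ∑ (comps n) (λ δ → [ δ == γ ]· [ β ≤C δ ]· 1ℚ)
          ≡⟨ cong (q *_) (∑-δ (λ δ → [ β ≤C δ ]· 1ℚ) (comps-unique n) (IsComp⇒∈comps iγ)) ⟩
        q * ([ β ≤C γ ]· 1ℚ)
          ≡⟨ *-[]· (β ≤C γ) q 1ℚ ⟩
        [ β ≤C γ ]· q * 1ℚ
          ≡⟨ cong (λ r → [ β ≤C γ ]· r) (ℚP.*-identityʳ q) ⟩
        [ β ≤C γ ]· q ∎

    module _ {π} (π∈ : π ∈ perms n) where

      length-π : length π ≡ n
      length-π = Permutation.length-σ {n} π∈

      Dπ-IsComp : IsComp n (D π)
      Dπ-IsComp = subst (λ m → IsComp m (D π)) length-π (D-IsComp π)

      lower-c-Y : ∀ {γ} → IsComp n γ → lower n (c (D π)) γ ≡ Y π γ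
      lower-c-Y {γ} iγ = trans (lower-c Dπ-IsComp iγ)
        (sym (trans (∑-E π (λ β → Φ β γ)) (cong (λ m → ∑ (comps m) (λ β → [ D π ≤C β ]· Φ β γ)) length-π)))

      -- Among the F of degree n only F_(n) contains M_(n), so its coefficient is the value of the
      -- character.
      c-top : c (D π) (top n) ≡ X π
      c-top = trans (sym (lower-top n (c (D π)))) (trans (lower-c-Y (top-IsComp n))
        (sym (trans (X-Y π) (cong (Y π ∘ top) length-π))))

      -- Every F_β of degree n contains M at (1ⁿ) exactly once, so the row sum is that coefficient
      -- of the image.
      ∑-c : ∑ (comps n) (c (D π)) ≡ powℚ (lam Φ) n
      ∑-c = trans (sym (lower-ones n (c (D π)))) (trans (lower-c-Y (ones-IsComp n))
        (subst (λ m → Y π (replicate m 1) ≡ powℚ (lam Φ) m) length-π (Y-ones π)))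

    N : ℚ
    N = ∑ (perms n) (λ σ → c (D σ) (top n))

    N≡λⁿ : N ≡ powℚ (lam Φ) n
    N≡λⁿ = trans (∑-cong∈ (perms n) c-top) (∑-perms-X n)

    Prob-X : ∀ {σ} → σ ∈ perms n → Prob n c σ ≡ X σ * recip N
    Prob-X σ∈ = trans (/′-recip _ N) (cong (_* recip N) (c-top σ∈))

    module _ {π} (π∈ : π ∈ perms n) where

      -- After exchanging the sums, the two equations D(ρ) = β and σπ = ρ each select one term, and
      -- only the sum over σ remains.
      lower-lumpSum : ∀ γ → lower n (lumpSum n c π) γ ≡
                      ∑ (perms n) (λ σ → [ D (σ ∘ₚ π) ≤C γ ]· Prob n c (inv σ))
      lower-lumpSum γ = begin
        ∑ (comps n) (λ β → [ β ≤C γ ]· ∑ (perms n) (λ ρ → [ D ρ == β ]· K n c π ρ))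
          ≡⟨ ∑-cong (comps n) (λ β → sym (trans (∑-cong (perms n) (λ ρ → []·-comm (D ρ == β) (β ≤C γ) (K n c π ρ))) (∑-[]· (β ≤C γ) (perms n) _))) ⟩
        ∑ (comps n) (λ β → ∑ (perms n) (λ ρ → [ D ρ == β ]· [ β ≤C γ ]· K n c π ρ))
          ≡⟨ ∑-swap (comps n) (perms n) (λ β ρ → [ D ρ == β ]· [ β ≤C γ ]· K n c π ρ) ⟩
        ∑ (perms n) (λ ρ → ∑ (comps n) (λ β → [ D ρ == β ]· [ β ≤C γ ]· K n c π ρ))
          ≡⟨ ∑-cong∈ (perms n) (λ {ρ} ρ∈ → ∑-δˡ (λ β → [ β ≤C γ ]· K n c π ρ) (comps-unique n) (IsComp⇒∈comps (Dπ-IsComp ρ∈))) ⟩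
        ∑ (perms n) (λ ρ → [ D ρ ≤C γ ]· ∑ (perms n) (λ σ → [ (σ ∘ₚ π) == ρ ]· Prob n c (inv σ)))
          ≡⟨ ∑-cong (perms n) (λ ρ → sym (trans (∑-cong (perms n) (λ σ → []·-comm ((σ ∘ₚ π) == ρ) (D ρ ≤C γ) (Prob n c (inv σ)))) (∑-[]· (D ρ ≤C γ) (perms n) _))) ⟩
        ∑ (perms n) (λ ρ → ∑ (perms n) (λ σ → [ (σ ∘ₚ π) == ρ ]· [ D ρ ≤C γ ]· Prob n c (inv σ)))
          ≡⟨ ∑-swap (perms n) (perms n) (λ ρ σ → [ (σ ∘ₚ π) == ρ ]· [ D ρ ≤C γ ]· Prob n c (inv σ)) ⟩
        ∑ (perms n) (λ σ → ∑ (perms n) (λ ρ → [ (σ ∘ₚ π) == ρ ]· [ D ρ ≤C γ ]· Prob n c (inv σ)))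
          ≡⟨ ∑-cong∈ (perms n) (λ {σ} σ∈ → ∑-δˡ (λ ρ → [ D ρ ≤C γ ]· Prob n c (inv σ)) (perms-unique n) (Permutation.∘-∈perms {n} σ∈ π∈)) ⟩
        ∑ (perms n) (λ σ → [ D (σ ∘ₚ π) ≤C γ ]· Prob n c (inv σ)) ∎
        where open ≡-Reasoning

      -- The comparison is made after summation over β ≤ γ. There both sides become `Y π γ` divided
      -- by the same number, as N equals λⁿ.
      lumpSum≡Kbar : ∀ {β} → IsComp n β → lumpSum n c π β ≡ Kbar n Φ c (D π) β
      lumpSum≡Kbar = lower-injective n (lumpSum n c π) (Kbar n Φ c (D π)) (λ {γ} iγ → begin
        lower n (lumpSum n c π) γ
          ≡⟨ lower-lumpSum γ ⟩
        ∑ (perms n) (λ σ → [ D (σ ∘ₚ π) ≤C γ ]· Prob n c (inv σ))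
          ≡⟨ ∑-cong∈ (perms n) (λ {σ} σ∈ → trans (cong (λ q → [ D (σ ∘ₚ π) ≤C γ ]· q) (Prob-X (Permutation.inv-∈perms {n} σ∈)))
               (sym ([]·-* (D (σ ∘ₚ π) ≤C γ) (X (inv σ)) (recip N)))) ⟩
        ∑ (perms n) (λ σ → ([ D (σ ∘ₚ π) ≤C γ ]· X (inv σ)) * recip N)
          ≡⟨ ∑-* (perms n) (λ σ → [ D (σ ∘ₚ π) ≤C γ ]· X (inv σ)) (recip N) ⟨
        ∑ (perms n) (λ σ → [ D (σ ∘ₚ π) ≤C γ ]· X (inv σ)) * recip N
          ≡⟨ cong (_* recip N) (∑-filter (λ σ → D (σ ∘ₚ π) ≤C γ) (perms n) (X ∘ inv)) ⟨
        ∑ (filter (λ σ → (D (σ ∘ₚ π) ≤C γ) Bool.≟ true) (perms n)) (X ∘ inv) * recip N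
          ≡⟨ cong (_* recip N) (∑-map inv (filter (λ σ → (D (σ ∘ₚ π) ≤C γ) Bool.≟ true) (perms n)) X) ⟨
        ∑ (map inv (filter (λ σ → (D (σ ∘ₚ π) ≤C γ) Bool.≟ true) (perms n))) X * recip N
          ≡⟨ cong (_* recip N) (∑-↭ X (inverses-↭-Sh π∈ iγ)) ⟩
        ∑ (Sh γ π) X * recip N
          ≡⟨ cong (_* recip N) (Y-Sh γ π (subst (λ m → IsComp m γ) (sym (length-π π∈)) iγ) (Permutation.σ-unique {n} π∈)) ⟨
        Y π γ * recip N
          ≡⟨ cong₂ (λ p q → p * recip q) (sym (lower-c-Y π∈ iγ)) N≡λⁿ ⟩
        lower n (c (D π)) γ * recip (powℚ (lam Φ) n)
          ≡⟨ ∑-* (comps n) (λ β → [ β ≤C γ ]· c (D π) β) (recip (powℚ (lam Φ) n)) ⟩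
        ∑ (comps n) (λ β → ([ β ≤C γ ]· c (D π) β) * recip (powℚ (lam Φ) n))
          ≡⟨ ∑-cong (comps n) (λ β → trans ([]·-* (β ≤C γ) (c (D π) β) (recip (powℚ (lam Φ) n)))
               (cong (λ q → [ β ≤C γ ]· q) (sym (/′-recip (c (D π) β) (powℚ (lam Φ) n))))) ⟩
        lower n (Kbar n Φ c (D π)) γ ∎)
        where open ≡-Reasoning

    module _ (c≥0 : ∀ {α} → α ∈ comps n → 0ℚ ≤ c α (top n))
             (c≢0 : Σ Comp (λ α → α ∈ comps n × c α (top n) ≢ 0ℚ)) where

      D∈comps : ∀ {σ} → σ ∈ perms n → D σ ∈ comps n
      D∈comps σ∈ = IsComp⇒∈comps (Dπ-IsComp σ∈)

      -- The composition with nonzero c_{α,(n)} is the descent composition of some permutation,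
      -- which contributes a positive term to a sum of nonnegative ones.
      N>0 : 0ℚ < N
      N>0 with D-surjective (∈comps⇒IsComp n (proj₁ (proj₂ c≢0)))
      ... | π , π∈ , Dπ≡α =
        ∑->0 (c≥0 ∘ D∈comps) π∈ (subst (λ α → 0ℚ < c α (top n)) (sym Dπ≡α) cα>0)
        where
        cα>0 : 0ℚ < c (proj₁ c≢0) (top n)
        cα>0 = ℚP.≰⇒> (λ cα≤0 → proj₂ (proj₂ c≢0) (ℚP.≤-antisym cα≤0 (c≥0 (proj₁ (proj₂ c≢0)))))

      λⁿ>0 : 0ℚ < powℚ (lam Φ) n
      λⁿ>0 = subst (0ℚ <_) N≡λⁿ N>0

      lumpSum≥0 : ∀ π β → 0ℚ ≤ lumpSum n c π β
      lumpSum≥0 π β = ∑-≥0 (perms n) (λ {ρ} _ → []·-≥0 (D ρ == β) (∑-≥0 (perms n) (λ {σ} σ∈ → []·-≥0 ((σ ∘ₚ π) == ρ)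
        (subst (0ℚ ≤_) (sym (/′-recip _ N)) (*-≥0 (c≥0 (D∈comps (Permutation.inv-∈perms {n} σ∈))) (recip-≥0 N>0))))))

      -- No sign of c_{α,β} is given for β other than (n); it is inherited from the lumped sum,
      -- which adds up probabilities, at a permutation with descent composition α.
      Kbar≥0 : ∀ {α β} → α ∈ comps n → β ∈ comps n → 0ℚ ≤ Kbar n Φ c α β
      Kbar≥0 {β = β} α∈ β∈ with π , π∈ , refl ← D-surjective (∈comps⇒IsComp n α∈) =
        subst (0ℚ ≤_) (lumpSum≡Kbar π∈ (∈comps⇒IsComp n β∈)) (lumpSum≥0 π β)

      ∑-Kbar : ∀ {α} → α ∈ comps n → ∑ (comps n) (Kbar n Φ c α) ≡ 1ℚ
      ∑-Kbar α∈ with π , π∈ , refl ← D-surjective (∈comps⇒IsComp n α∈) = begin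
        ∑ (comps n) (Kbar n Φ c (D π))                   ≡⟨ ∑-cong (comps n) (λ β → /′-recip (c (D π) β) λⁿ) ⟩
        ∑ (comps n) (λ β → c (D π) β * recip λⁿ)         ≡⟨ ∑-* (comps n) (c (D π)) (recip λⁿ) ⟨
        ∑ (comps n) (c (D π)) * recip λⁿ                 ≡⟨ cong (_* recip λⁿ) (∑-c π∈) ⟩
        λⁿ * recip λⁿ                                    ≡⟨ *-recip (≢-sym (ℚP.<⇒≢ λⁿ>0)) ⟩
        1ℚ                                               ∎
        where
        open ≡-Reasoning
        λⁿ : ℚ
        λⁿ = powℚ (lam Φ) n

theorem3p1 : (n : ℕ) (Φ : Endo) → IsHopfEndo Φ →
    (c : Comp → Comp → ℚ) →
    (∀ {α} → α ∈ comps n → ∀ γ →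
    coef (apply Φ (F α)) γ ≡ coef (concatMap (λ β → scale (c α β) (F β)) (comps n)) γ) →
    (∀ {α} → α ∈ comps n → 0ℚ ≤ c α (top n)) →
    Σ Comp (λ α → α ∈ comps n × c α (top n) ≢ 0ℚ) →
    (0ℚ < powℚ (lam Φ) n)
    × (∀ {α β} → α ∈ comps n → β ∈ comps n → 0ℚ ≤ Kbar n Φ c α β)
    × (∀ {α} → α ∈ comps n → sumℚ (map (Kbar n Φ c α) (comps n)) ≡ 1ℚ)
    × (∀ {β π τ} → β ∈ comps n → π ∈ perms n → τ ∈ perms n → D π ≡ D τ →
    (lumpSum n c π β ≡ lumpSum n c τ β) × (lumpSum n c π β ≡ Kbar n Φ c (D π) β))
theorem3p1 n Φ hopf c expand c≥0 c≢0 =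
  λⁿ>0 c≥0 c≢0 , Kbar≥0 c≥0 c≢0 , ∑-Kbar c≥0 c≢0 , λ {β} {π} {τ} β∈ π∈ τ∈ Dπ≡Dτ →
    let iβ = ∈comps⇒IsComp n β∈ in
    trans (lumpSum≡Kbar π∈ iβ) (trans (cong (λ α → Kbar n Φ c α β) Dπ≡Dτ) (sym (lumpSum≡Kbar τ∈ iβ))) , lumpSum≡Kbar π∈ iβ
  where open Matrix.Degree Φ hopf n c expand
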